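{- For $n\ge 0$ let $M_n$ be the thagomizer matroid and $P_n(t)$ its Kazhdan–Lusztig polynomial, let $c_{n,k}$ denote the coefficient of $t^k$ in $P_n(t)$, and set $\Phi(t,u):=\sum_{n=0}^\infty P_n(t)\,u^{n+1}\in\mathbb{Z}[t][[u]]$. The following (equivalent) statements hold. (1) For all $n\ge 0$ and $k\ge 0$, $c_{n,k}$ equals the number of Dyck paths of semilength $n$ with exactly $k$ long ascents. (2) As formal power series, \[\Phi(t,u)=\frac{1-\sqrt{1-4u(1-u+tu)}}{2(1-u+tu)},\] where the square root denotes the formal power series in $u$ with constant term $1$.
   Context: The thagomizer matroid $M_n$ is the graphic matroid (cycle matroid) of the graph obtained from the complete bipartite graph $K_{2,n}$, with parts $\{A,B\}$ and $\{1,\dots,n\}$, by adding an edge $AB$ between the two distinguished vertices $A,B$. Its ground set is the set of $2n+1$ edges and it has rank $n+1$ (for $n=0$ it is the matroid of a single edge $AB$, of rank $1$). For a matroid $M$ with lattice of flats $L(M)$ and flat $F$: the localization $M_F$ is the matroid on ground set $F$ whose lattice of flats is $\{G\in L(M): G\subseteq F\}$; the contraction $M^F$ is the matroid on $E\setminus F$ whose lattice of flats is $\{G\setminus F: G\in L(M), G\supseteq F\}$; $\chi_M(t)$ is the characteristic polynomial. The Kazhdan–Lusztig polynomial $P_M(t)\in\mathbb{Z}[t]$ is the unique assignment of polynomials to matroids such that: $P_M(t)=1$ if $\operatorname{rk}M=0$; $\deg P_M(t)<\tfrac12\operatorname{rk}M$ if $\operatorname{rk}M>0$; and for every $M$, $t^{\operatorname{rk}M}P_M(t^{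 -1})=\sum_{F\in L(M)}\chi_{M_F}(t)\,P_{M^F}(t)$. A Dyck path of semilength $n$ is a lattice path from $(0,0)$ to $(2n,0)$ using steps $u=(1,1)$ and $d=(1,-1)$ that never goes below the $x$-axis. A long ascent is a maximal run of consecutive $u$ steps of length at least $2$. -}

module Defs where

open import Data.Bool using (Bool; true; false; _∧_; _∨_; not; if_then_else_)
open import Data.Nat as ℕ using (ℕ; zero; suc; _∸_; _<ᵇ_; _≡ᵇ_; ⌈_/2⌉)
open import Data.Integer as ℤ using (ℤ; +_; -[1+_])
open import Data.Fin as Fin using (Fin)
open import Data.Fin.Subset using (Subset; _∪_; _─_; ⁅_⁆; ⊤; ∣_∣)
open import Data.List as List using (List; []; _∷_; _++_; map; filterᵇ; length; foldr; allFin; upTo; concatMap; take)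
open import Data.Vec as Vec using (Vec; []; _∷_; lookup; fromList)
open import Data.Product using (_×_; _,_)
open import Relation.Binary.PropositionalEquality using (_≡_)
open import Relation.Nullary.Decidable using (⌊_⌋)

-- Polynomials in ℤ[t]: coefficient lists, constant term first.

Poly : Set
Poly = List ℤ

coeff : Poly → ℕ → ℤ
coeff []       _       = + 0
coeff (a ∷ _)  zero    = a
coeff (_ ∷ p)  (suc k) = coeff p k

_+P_ : Poly → Poly → Poly
[]      +P q       = q
(a ∷ p) +P []      = a ∷ p
(a ∷ p) +P (b ∷ q) = (a ℤ.+ b) ∷ (p +P q)

scaleP : ℤ → Poly → Poly
scaleP c = map (c ℤ.*_)

negP : Poly → Poly
negP = scaleP (ℤ.- (+ 1))

_*P_ : Poly → Poly → Poly
[]      *P q = []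
(a ∷ p) *P q = scaleP a q +P (+ 0 ∷ (p *P q))

sumP : List Poly → Poly
sumP = foldr _+P_ []

tpow : ℕ → Poly
tpow zero    = + 1 ∷ []
tpow (suc k) = + 0 ∷ tpow k

-- equality of polynomials (coefficientwise, so trailing zeros are irrelevant)
_≈P_ : Poly → Poly → Set
p ≈P q = ∀ k → coeff p k ≡ coeff q k

Ser : Set
Ser = ℕ → Poly

_≈S_ : Ser → Ser → Set
f ≈S g = ∀ j → f j ≈P g j

_+S_ : Ser → Ser → Ser
(f +S g) j = f j +P g j

_-S_ : Ser → Ser → Ser
(f -S g) j = f j +P negP (g j)

_*S_ : Ser → Ser → Ser
(f *S g) j = sumP (map (λ i → f i *P g (j ∸ i)) (upTo (suc j)))

constS : ℤ → Ser
constS c zero    = c ∷ []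
constS c (suc _) = []

uS : Ser
uS (suc zero) = + 1 ∷ []
uS _          = []

tS : Ser
tS zero    = tpow 1
tS (suc _) = []

-- Matroids given by a rank function on subsets of a ground set E ⊆ Fin m.
-- (Only matroids arising from graphs via localization/contraction at flats
--  are ever fed to these definitions.)

record Mat : Set where
  field
    m  : ℕ
    E  : Subset m
    rk : Subset m → ℕ
open Mat public

subsets : (m : ℕ) → List (Subset m)
subsets zero    = [] ∷ []
subsets (suc m) = map (false ∷_) (subsets m) ++ map (true ∷_) (subsets m)

_⊆ᵇ_ : ∀ {m} → Subset m → Subset m → Bool
[]      ⊆ᵇ []      = true
(x ∷ xs) ⊆ᵇ (y ∷ ys) = (not x ∨ y) ∧ (xs ⊆ᵇ ys)

allᵇ : ∀ {A : Set} → (A → Bool) → List A → Bool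
allᵇ p = foldr (λ a b → p a ∧ b) true

rank : Mat → ℕ
rank M = rk M (E M)

isFlat : (M : Mat) → Subset (m M) → Bool
isFlat M G = (G ⊆ᵇ E M) ∧
  allᵇ (λ e → not (lookup (E M) e ∧ not (lookup G e)) ∨ (rk M G <ᵇ rk M (G ∪ ⁅ e ⁆)))
       (allFin (m M))

flats : (M : Mat) → List (Subset (m M))
flats M = filterᵇ (isFlat M) (subsets (m M))

localize : (M : Mat) → Subset (m M) → Mat
localize M F = record { m = m M ; E = F ; rk = rk M }

contract : (M : Mat) → Subset (m M) → Mat
contract M F = record { m = m M ; E = E M ─ F ; rk = λ X → rk M (X ∪ F) ∸ rk M F }

sign : ℕ → ℤ
sign zero    = + 1
sign (suc k) = ℤ.- sign k

charPoly : Mat → Poly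
charPoly M = sumP (map (λ X → scaleP (sign ∣ X ∣) (tpow (rank M ∸ rk M X)))
                       (filterᵇ (λ X → X ⊆ᵇ E M) (subsets (m M))))

-- Kazhdan–Lusztig polynomial, by recursion on rank (fuel ≥ rank).
-- Solving  t^r P(1/t) = Σ_F χ_{M_F}(t) P_{M^F}(t)  with deg P < r/2:
-- the F = cl(∅) term is P_M itself, so P_M = −(part of degree < r/2 of
-- Σ_{F flat, rk F > 0} χ_{M_F} P_{M^F}).
KLfuel : ℕ → Mat → Poly
KLfuel zero    M = + 1 ∷ []
KLfuel (suc f) M with rank M
... | zero  = + 1 ∷ []
... | suc r = negP (take ⌈ suc r /2⌉
                (sumP (map (λ F → charPoly (localize M F) *P KLfuel f (contract M F))
                           (filterᵇ (λ F → 0 <ᵇ rk M F) (flats M)))))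

KL : Mat → Poly
KL M = KLfuel (rank M) M

-- merge components along the selected edges; labels are component representatives
labels : ∀ {v k} → (Fin v → Fin v) → Vec (Fin v × Fin v) k → Subset k → (Fin v → Fin v)
labels lab []             []           = lab
labels lab (_       ∷ es) (false ∷ xs) = labels lab es xs
labels lab ((a , b) ∷ es) (true ∷ xs)  =
  labels (λ x → if ⌊ lab x Fin.≟ lab b ⌋ then lab a else lab x) es xs

components : ∀ {v k} → Vec (Fin v × Fin v) k → Subset k → ℕ
components {v} es X =
  length (filterᵇ (λ x → ⌊ labels (λ y → y) es X x Fin.≟ x ⌋) (allFin v))

graphicMatroid : (v : ℕ) → (es : List (Fin v × Fin v)) → Mat
graphicMatroid v es = record
  { m  = length es
  ; E  = ⊤
  ; rk = λ X → v ∸ components (fromList es) X }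

-- Thagomizer graph: K_{2,n} on {A,B} ∪ {1..n} plus the edge AB.
-- Vertices Fin (2 + n): A = 0, B = 1, vertex i ↦ 2 + i.
thagEdges : (n : ℕ) → List (Fin (suc (suc n)) × Fin (suc (suc n)))
thagEdges n = (Fin.zero , Fin.suc Fin.zero) ∷
  concatMap (λ i → (Fin.zero , Fin.suc (Fin.suc i)) ∷ (Fin.suc Fin.zero , Fin.suc (Fin.suc i)) ∷ [])
            (allFin n)

thagomizer : ℕ → Mat
thagomizer n = graphicMatroid (suc (suc n)) (thagEdges n)

Pthag : ℕ → Poly
Pthag n = KL (thagomizer n)

Φ : Ser
Φ zero    = []
Φ (suc n) = Pthag n

-- Dyck paths: words over {u = true, d = false}.

words : ℕ → List (List Bool)
words zero    = [] ∷ []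
words (suc L) = map (true ∷_) (words L) ++ map (false ∷_) (words L)

dyckFrom : ℕ → List Bool → Bool
dyckFrom h       []            = h ≡ᵇ 0
dyckFrom h       (true ∷ s)    = dyckFrom (suc h) s
dyckFrom zero    (false ∷ s)   = false
dyckFrom (suc h) (false ∷ s)   = dyckFrom h s

isDyck : List Bool → Bool
isDyck = dyckFrom 0

endRun : ℕ → ℕ
endRun r = if 1 <ᵇ r then 1 else 0

longAscFrom : ℕ → List Bool → ℕ
longAscFrom r []          = endRun r
longAscFrom r (true ∷ s)  = longAscFrom (suc r) s
longAscFrom r (false ∷ s) = endRun r ℕ.+ longAscFrom 0 s

longAscents : List Bool → ℕ
longAscents = longAscFrom 0

dyckCount : ℕ → ℕ → ℕ
dyckCount n k = length (filterᵇ (λ w → isDyck w ∧ (longAscents w ≡ᵇ k)) (words (n ℕ.+ n)))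

{-# OPTIONS --safe #-}

-- All minors M_n/F by flats are again thagomizer matroids up to parallel elements (if AB ∉ F) or Boolean
-- matroids up to parallel elements (if AB ∈ F), with Kazhdan–Lusztig polynomials P_j and 1 respectively.
-- With b = t − 1, the flats containing AB contribute b (1 + (b − 1))ⁿ = bⁿ⁺¹ to the recursion and the others
-- contribute Σ_k C(n,k) (2b)ᵏ P_{n−k}, so the recursion says that
--     G_n = bⁿ⁺¹ + Σ_k C(n,k) (2b)ᵏ P_{n−k}
-- is tⁿ⁺¹ P_n(1/t).  Let F = Σ D_n uⁿ count Dyck paths by long ascents; decomposing paths gives
-- F = 1 + u F² + b u² F².  The binomial transform is the substitution u ↦ u/(1 − 2bu) in uF, so G, formed with
-- D in place of P, satisfies G = t + u G² − b u² G².  Hence G_n is divisible by t^((n+2)/2), while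
-- D_n has degree at most n/2; both together say that D solves the recursion, so P = D.
module Submission where

open import Defs
open import Level using (0ℓ)
open import Algebra.Bundles using (CommutativeRing)
import Algebra.Properties.CommutativeSemigroup as CommSemigroup
import Algebra.Properties.Ring as RingProps
import Algebra.Solver.Ring.NaturalCoefficients.Default as NatSolver
import Relation.Binary.Reasoning.Setoid as SetoidReasoning
open import Data.Bool using (Bool; true; false; _∧_; _∨_; not; if_then_else_)
open import Data.Bool.Properties using (∨-identityʳ; ∧-identityʳ; ∧-zeroʳ; ∨-zeroʳ; ∨-assoc; ∧-conicalʳ)
open import Data.Nat as ℕ using (ℕ; zero; suc; _∸_; _≤_; _<_; _<ᵇ_; _≡ᵇ_; z≤n; s≤s; ⌈_/2⌉)
import Data.Nat.Properties as ℕP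
open import Data.Nat.Solver using (module +-*-Solver)
open import Data.Integer as ℤ using (ℤ; +_)
import Data.Integer.Properties as ℤP
open import Data.Fin as Fin using (Fin)
open import Data.Fin.Properties using (suc-injective)
open import Data.Fin.Subset using (Subset; _∪_; _─_; ⁅_⁆; ⊥; ⊤; ∣_∣)
open import Data.Fin.Subset.Properties using (∪-identityʳ)
open import Data.List using (List; []; _∷_; _++_; map; filterᵇ; length; take; tabulate; allFin; concatMap; upTo; applyUpTo)
open import Data.List.Properties using (map-applyUpTo)
open import Data.Vec using (Vec; []; _∷_; lookup; fromList; replicate)
open import Data.Product using (Σ; _×_; _,_)
open import Data.Sum using (_⊎_; inj₁; inj₂)
open import Function using (_∘_; id)
open import Relation.Nullary using (Dec; ¬_; yes; no; contradiction)
open import Relation.Nullary.Decidable using (⌊_⌋; dec-true; dec-false; isYes≗does)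

-- Power series over a commutative ring

-- `KLfuel` negates the lower part of the sum over flats of positive rank. A candidate q therefore
-- equals P once two facts are known: adding q to that sum kills every coefficient below the
-- truncation degree, and q has no coefficient from there on. The completed sum is G. That its low
-- coefficients vanish cannot be seen from the binomial sum; the quadratic equation turns it into an
-- induction, because orders in t add up in G². The constants: a vertex joined to both A and B forms
-- a triangle with AB and contributes t - 2 = b - 1; a vertex joined by one edge contributes t - 1 =
-- b, in two ways. The resulting 2b is also what the algebra requires: 2bV is the cross term of
-- (b/(1 - bu) + V)² times 1 - bu. On the matroid side, contraction keeps the index set and leaves
-- parallel edges, so the induction must cover all minors, with ground sets and rank functions known
-- only up to equations. On the algebraic side the solver works in commutative semirings, so
-- identities are stated with subtracted terms moved across.

module PowerSeries (R : CommutativeRing 0ℓ 0ℓ) where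
  open CommutativeRing R
  open SetoidReasoning setoid
  private module S = NatSolver commutativeSemiring
  open S using (_:+_; _:*_; _:=_)

  Series : Set
  Series = ℕ → Carrier

  shift : Series → Series
  shift f n = f (suc n)

  infix 4 _≋_
  _≋_ : Series → Series → Set
  f ≋ g = ∀ n → f n ≈ g n

  infixl 6 _⊕_
  infixl 7 _⊛_ _·_

  _⊕_ : Series → Series → Series
  (f ⊕ g) n = f n + g n

  _·_ : Carrier → Series → Series
  (c · f) n = c * f n

  ⊖_ : Series → Series
  (⊖ f) n = - f n

  -- The Cauchy product, unrolled along the left factor. Its laws become inductions on the index
  -- that generalise over the series, without finite sums.
  _⊛_ : Series → Series → Series
  (f ⊛ g) zero    = f 0 * g 0
  (f ⊛ g) (suc n) = f 0 * g (suc n) + (shift f ⊛ g) n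

  const : Carrier → Series
  const c zero    = c
  const c (suc _) = 0#

  X·_ : Series → Series
  (X· f) zero    = 0#
  (X· f) (suc n) = f n

  ⊛-cong : ∀ {f f′ g g′} → f ≋ f′ → g ≋ g′ → f ⊛ g ≋ f′ ⊛ g′
  ⊛-cong p q zero    = *-cong (p 0) (q 0)
  ⊛-cong p q (suc n) = +-cong (*-cong (p 0) (q (suc n))) (⊛-cong (λ m → p (suc m)) q n)

  -- The product unrolled along the right factor instead; comparing the two unrollings gives
  -- commutativity.
  ⊛-sucʳ : ∀ f g n → (f ⊛ g) (suc n) ≈ (f ⊛ shift g) n + f (suc n) * g 0
  ⊛-sucʳ f g zero    = refl
  ⊛-sucʳ f g (suc n) = trans (+-congˡ (⊛-sucʳ (shift f) g n)) (sym (+-assoc _ _ _))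

  ⊛-comm : ∀ f g → f ⊛ g ≋ g ⊛ f
  ⊛-comm f g zero    = *-comm _ _
  ⊛-comm f g (suc n) = begin
    f 0 * g (suc n) + (shift f ⊛ g) n  ≈⟨ +-cong (*-comm _ _) (⊛-comm (shift f) g n) ⟩
    g (suc n) * f 0 + (g ⊛ shift f) n  ≈⟨ +-comm _ _ ⟩
    (g ⊛ shift f) n + g (suc n) * f 0  ≈⟨ sym (⊛-sucʳ g f n) ⟩
    (g ⊛ f) (suc n)                    ∎

  ⊛-distribʳ : ∀ h f g → (f ⊕ g) ⊛ h ≋ f ⊛ h ⊕ g ⊛ h
  ⊛-distribʳ h f g zero    = distribʳ _ _ _
  ⊛-distribʳ h f g (suc n) = trans (+-cong (distribʳ _ _ _) (⊛-distribʳ h (shift f) (shift g) n))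
    (S.solve 4 (λ a b c d → (a :+ b) :+ (c :+ d) := (a :+ c) :+ (b :+ d)) refl _ _ _ _)

  ⊛-distribˡ : ∀ h f g → h ⊛ (f ⊕ g) ≋ h ⊛ f ⊕ h ⊛ g
  ⊛-distribˡ h f g n = begin
    (h ⊛ (f ⊕ g)) n        ≈⟨ ⊛-comm h (f ⊕ g) n ⟩
    ((f ⊕ g) ⊛ h) n        ≈⟨ ⊛-distribʳ h f g n ⟩
    (f ⊛ h) n + (g ⊛ h) n  ≈⟨ +-cong (⊛-comm f h n) (⊛-comm g h n) ⟩
    (h ⊛ f) n + (h ⊛ g) n  ∎

  ·-⊛ : ∀ c f g → (c · f) ⊛ g ≋ c · (f ⊛ g)
  ·-⊛ c f g zero    = *-assoc _ _ _
  ·-⊛ c f g (suc n) = trans (+-cong (*-assoc _ _ _) (·-⊛ c (shift f) g n)) (sym (distribˡ _ _ _))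

  ⊛-assoc : ∀ f g h → (f ⊛ g) ⊛ h ≋ f ⊛ (g ⊛ h)
  ⊛-assoc f g h zero    = *-assoc _ _ _
  ⊛-assoc f g h (suc n) = begin
    -- `shift (f ⊛ g)` is by definition `f 0 · shift g ⊕ shift f ⊛ g`.
    (f 0 * g 0) * h (suc n) + ((f 0 · shift g ⊕ shift f ⊛ g) ⊛ h) n
      ≈⟨ +-congˡ (trans (⊛-distribʳ h (f 0 · shift g) (shift f ⊛ g) n)
                        (+-cong (·-⊛ (f 0) (shift g) h n) (⊛-assoc (shift f) g h n))) ⟩
    (f 0 * g 0) * h (suc n) + (f 0 * (shift g ⊛ h) n + (shift f ⊛ (g ⊛ h)) n)
      ≈⟨ S.solve 5 (λ a b c d e → (a :* b) :* c :+ (a :* d :+ e) := a :* (b :* c :+ d) :+ e) refl _ _ _ _ _ ⟩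
    f 0 * (g 0 * h (suc n) + (shift g ⊛ h) n) + (shift f ⊛ (g ⊛ h)) n ∎

  ⊛-zeroˡ : ∀ {f} g → (∀ n → f n ≈ 0#) → ∀ n → (f ⊛ g) n ≈ 0#
  ⊛-zeroˡ g f≈0 zero    = trans (*-congʳ (f≈0 0)) (zeroˡ _)
  ⊛-zeroˡ g f≈0 (suc n) = trans (+-cong (trans (*-congʳ (f≈0 0)) (zeroˡ _)) (⊛-zeroˡ g (λ m → f≈0 (suc m)) n))
                                (+-identityʳ 0#)

  const-⊛ : ∀ c f → const c ⊛ f ≋ c · f
  const-⊛ c f zero    = refl
  const-⊛ c f (suc n) = trans (+-congˡ (⊛-zeroˡ f (λ _ → refl) n)) (+-identityʳ _)

  X·-⊛ : ∀ f g → (X· f) ⊛ g ≋ X· (f ⊛ g)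
  X·-⊛ f g zero    = zeroˡ _
  X·-⊛ f g (suc n) = trans (+-congʳ (zeroˡ _)) (+-identityˡ _)

  X·-cong : ∀ {f g} → f ≋ g → X· f ≋ X· g
  X·-cong p zero    = refl
  X·-cong p (suc n) = p n

  -- Bundled so that the construction can be iterated, first in t and then in u, with ring lemmas
  -- and solver at each level.
  ring′ : CommutativeRing 0ℓ 0ℓ
  ring′ = record
    { Carrier = Series ; _≈_ = _≋_ ; _+_ = _⊕_ ; _*_ = _⊛_ ; -_ = ⊖_ ; 0# = λ _ → 0# ; 1# = const 1#
    ; isCommutativeRing = record
      { isRing = record
        { +-isAbelianGroup = record
          { isGroup = record
            { isMonoid = record
              { isSemigroup = record
                { isMagma = record
                  { isEquivalence = record
                    { refl  = λ _ → refl
                    ; sym   = λ p n → sym (p n)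
                    ; trans = λ p q n → trans (p n) (q n) }
                  ; ∙-cong = λ p q n → +-cong (p n) (q n) }
                ; assoc = λ _ _ _ _ → +-assoc _ _ _ }
              ; identity = (λ _ _ → +-identityˡ _) , (λ _ _ → +-identityʳ _) }
            ; inverse = (λ _ _ → -‿inverseˡ _) , (λ _ _ → -‿inverseʳ _)
            ; ⁻¹-cong = λ p n → -‿cong (p n) }
          ; comm = λ _ _ _ → +-comm _ _ }
        ; *-cong = ⊛-cong
        ; *-assoc = ⊛-assoc
        ; *-identity = ⊛-identityˡ , (λ f n → trans (⊛-comm f (const 1#) n) (⊛-identityˡ f n))
        ; distrib = ⊛-distribˡ , ⊛-distribʳ }
      ; *-comm = ⊛-comm } }
    where
    ⊛-identityˡ : ∀ f → const 1# ⊛ f ≋ f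
    ⊛-identityˡ f n = trans (const-⊛ 1# f n) (*-identityˡ _)

  X·-⊕ : ∀ f g → X· (f ⊕ g) ≋ X· f ⊕ X· g
  X·-⊕ f g zero    = sym (+-identityˡ 0#)
  X·-⊕ f g (suc n) = refl

  infixr 8 _^^_
  -- Powers of an element, and at the same time the coefficients of the geometric series 1/(1 - bu).
  _^^_ : Carrier → Series
  (b ^^ zero)    = 1#
  (b ^^ (suc n)) = b * (b ^^ n)

  -- Σ_k C(n,k) aᵏ f(n−k); on generating functions Σ f(n) uⁿ⁺¹ this is the substitution u ↦ u/(1 − a u).
  binomialTransform : Carrier → Series → Series
  binomialTransform a f zero    = f 0
  binomialTransform a f (suc n) = a * binomialTransform a f n + binomialTransform a (shift f) n

  module BinomialTransform (a : Carrier) where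
    B : Series → Series
    B = binomialTransform a

    B-cong : ∀ {f g} → f ≋ g → B f ≋ B g
    B-cong p zero    = p 0
    B-cong p (suc n) = +-cong (*-congˡ (B-cong p n)) (B-cong (λ m → p (suc m)) n)

    B-⊕ : ∀ f g → B (f ⊕ g) ≋ B f ⊕ B g
    B-⊕ f g zero    = refl
    B-⊕ f g (suc n) = trans (+-cong (*-congˡ (B-⊕ f g n)) (B-⊕ (shift f) (shift g) n))
      (S.solve 5 (λ a x y z w → a :* (x :+ y) :+ (z :+ w) := (a :* x :+ z) :+ (a :* y :+ w)) refl _ _ _ _ _)

    B-· : ∀ c f → B (c · f) ≋ c · B f
    B-· c f zero    = refl
    B-· c f (suc n) = trans (+-cong (*-congˡ (B-· c f n)) (B-· c (shift f) n))
      (S.solve 4 (λ a c x y → a :* (c :* x) :+ c :* y := c :* (a :* x :+ y)) refl _ _ _ _)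

    -- As generating functions in u, `B f` is f(u/(1 - au))/(1 - au), so both identities say B(fg) =
    -- (1 - au) · Bf · Bg. The first one expands (1 - au) · Bf as `f 0` plus u times `B (shift f)`;
    -- each is proved from the other at a smaller index.
    B-⊛-shift : ∀ f g n → B (f ⊛ g) n ≈ f 0 * B g n + (X· (B (shift f) ⊛ B g)) n
    B-⊛       : ∀ f g n → B (f ⊛ g) n + a * (X· (B f ⊛ B g)) n ≈ (B f ⊛ B g) n

    private
      B-⊛-suc : ∀ f g n → B (shift (f ⊛ g)) n ≈ f 0 * B (shift g) n + B (shift f ⊛ g) n
      B-⊛-suc f g n = trans (B-⊕ (f 0 · shift g) (shift f ⊛ g) n) (+-congʳ (B-· (f 0) (shift g) n))

    B-⊛-shift f g zero    = sym (+-identityʳ _)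
    B-⊛-shift f g (suc n) = begin
      a * B (f ⊛ g) n + B (shift (f ⊛ g)) n
        ≈⟨ +-cong (*-congˡ (B-⊛-shift f g n)) (B-⊛-suc f g n) ⟩
      a * (f 0 * B g n + (X· (B (shift f) ⊛ B g)) n) + (f 0 * B (shift g) n + B (shift f ⊛ g) n)
        ≈⟨ S.solve 6 (λ a f x y z w → a :* (f :* x :+ y) :+ (f :* z :+ w)
                                    := f :* (a :* x :+ z) :+ (w :+ a :* y)) refl _ _ _ _ _ _ ⟩
      f 0 * B g (suc n) + (B (shift f ⊛ g) n + a * (X· (B (shift f) ⊛ B g)) n)
        ≈⟨ +-congˡ (B-⊛ (shift f) g n) ⟩
      f 0 * B g (suc n) + (B (shift f) ⊛ B g) n ∎

    B-⊛ f g zero    = trans (+-congˡ (zeroʳ a)) (+-identityʳ _)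
    B-⊛ f g (suc n) = begin
      (a * B (f ⊛ g) n + B (shift (f ⊛ g)) n) + a * (B f ⊛ B g) n
        ≈⟨ +-congʳ (+-cong (*-congˡ (B-⊛-shift f g n)) (B-⊛-suc f g n)) ⟩
      (a * (f 0 * B g n + (X· (B (shift f) ⊛ B g)) n) + (f 0 * B (shift g) n + B (shift f ⊛ g) n))
        + a * (B f ⊛ B g) n
        ≈⟨ S.solve 7 (λ a f x y z w v → (a :* (f :* x :+ y) :+ (f :* z :+ w)) :+ a :* v
                                      := f :* (a :* x :+ z) :+ (a :* v :+ (w :+ a :* y))) refl _ _ _ _ _ _ _ ⟩
      f 0 * B g (suc n) + (a * (B f ⊛ B g) n + (B (shift f ⊛ g) n + a * (X· (B (shift f) ⊛ B g)) n))
        ≈⟨ +-congˡ (+-congˡ (B-⊛ (shift f) g n)) ⟩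
      f 0 * B g (suc n) + (a * (B f ⊛ B g) n + (B (shift f) ⊛ B g) n)
        ≈⟨ +-congˡ (sym (trans (⊛-distribʳ (B g) (a · B f) (B (shift f)) n) (+-congʳ (·-⊛ a (B f) (B g) n)))) ⟩
      (B f ⊛ B g) (suc n) ∎

    -- The factor u becomes u/(1 - au) and supplies the second denominator, so no correction term
    -- appears here.
    B-X : ∀ f g → B (X· (f ⊛ g)) ≋ X· (B f ⊛ B g)
    B-X f g n = begin
      B (X· (f ⊛ g)) n                            ≈⟨ B-cong (λ m → sym (X·-⊛ f g m)) n ⟩
      B ((X· f) ⊛ g) n                            ≈⟨ B-⊛-shift (X· f) g n ⟩
      0# * B g n + (X· (B f ⊛ B g)) n             ≈⟨ trans (+-congʳ (zeroˡ _)) (+-identityˡ _) ⟩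
      (X· (B f ⊛ B g)) n                          ∎

  -- F = 1 + u F² + b u² F² passes to G = b/(1 − b u) + BF as G = (1 + b) + u G² − b u² G².
  module Reciprocal (b : Carrier) (F : Series)
           (F-suc : shift F ≋ F ⊛ F ⊕ b · (X· (F ⊛ F))) where
    open BinomialTransform (b + b)

    V P G : Series
    V   = B F
    P n = b ^^ suc n
    G   = P ⊕ V

    V-suc : ∀ n → V (suc n) ≈ ((b + b) * V n + B (F ⊛ F) n) + b * (X· (V ⊛ V)) n
    V-suc n = trans (+-congˡ (trans (B-cong F-suc n) (trans (B-⊕ (F ⊛ F) (b · (X· (F ⊛ F))) n)
        (+-congˡ (trans (B-· b (X· (F ⊛ F)) n) (*-congˡ (B-X F F n)))))))
      (sym (+-assoc _ _ _))

    -- `P` is the series b/(1 - bu), hence (1 - bu) · P · h = b · h.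
    P-⊛ : ∀ h n → (P ⊛ h) n ≈ b * h n + b * (X· (P ⊛ h)) n
    P-⊛ h zero    = trans (*-congʳ (*-identityʳ b)) (sym (trans (+-congˡ (zeroʳ b)) (+-identityʳ _)))
    P-⊛ h (suc n) = +-cong (*-congʳ (*-identityʳ b)) (·-⊛ b P h n)

    G-⊛ : G ⊛ G ≋ (P ⊛ P ⊕ P ⊛ V) ⊕ (P ⊛ V ⊕ V ⊛ V)
    G-⊛ n = begin
      (G ⊛ G) n                                                     ≈⟨ ⊛-distribʳ G P V n ⟩
      (P ⊛ G) n + (V ⊛ G) n                                         ≈⟨ +-cong (⊛-distribˡ P P V n) (⊛-distribˡ V P V n) ⟩
      ((P ⊛ P) n + (P ⊛ V) n) + ((V ⊛ P) n + (V ⊛ V) n)             ≈⟨ +-congˡ (+-congʳ (⊛-comm V P n)) ⟩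
      ((P ⊛ P) n + (P ⊛ V) n) + ((P ⊛ V) n + (V ⊛ V) n)             ∎

    X·-G-⊛ : ∀ n → (X· (G ⊛ G)) n ≈
             ((X· (P ⊛ P)) n + (X· (P ⊛ V)) n) + ((X· (P ⊛ V)) n + (X· (V ⊛ V)) n)
    X·-G-⊛ n = trans (X·-cong G-⊛ n) (trans (X·-⊕ (P ⊛ P ⊕ P ⊛ V) (P ⊛ V ⊕ V ⊛ V) n)
      (+-cong (X·-⊕ (P ⊛ P) (P ⊛ V) n) (X·-⊕ (P ⊛ V) (V ⊛ V) n)))

    -- In (1 - bu)(P + V)² the terms with `P` become bP + 2bV. The transform with parameter `b + b`
    -- produces this same 2bV in `V-suc`, and there B(F²) = (1 - 2bu)V² together with buV² leaves (1
    -- - bu)V².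
    G-suc : ∀ n → G (suc n) + b * (X· (G ⊛ G)) n ≈ (G ⊛ G) n
    G-suc n = begin
      (b * P n + V (suc n)) + b * (X· (G ⊛ G)) n
        ≈⟨ +-cong (+-congˡ (V-suc n)) (*-congˡ (X·-G-⊛ n)) ⟩
      (b * P n + (((b + b) * V n + B (F ⊛ F) n) + b * xvv)) + b * ((xpp + xpv) + (xpv + xvv))
        ≈⟨ S.solve 7 (λ b p v w xpp xpv xvv →
             (b :* p :+ (((b :+ b) :* v :+ w) :+ b :* xvv)) :+ b :* ((xpp :+ xpv) :+ (xpv :+ xvv))
             := ((b :* p :+ b :* xpp) :+ (b :* v :+ b :* xpv))
                :+ ((b :* v :+ b :* xpv) :+ (w :+ (b :+ b) :* xvv))) refl _ _ _ _ _ _ _ ⟩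
      ((b * P n + b * xpp) + (b * V n + b * xpv)) + ((b * V n + b * xpv) + (B (F ⊛ F) n + (b + b) * xvv))
        ≈⟨ sym (+-cong (+-cong (P-⊛ P n) (P-⊛ V n)) (+-cong (P-⊛ V n) (sym (B-⊛ F F n)))) ⟩
      ((P ⊛ P) n + (P ⊛ V) n) + ((P ⊛ V) n + (V ⊛ V) n)
        ≈⟨ sym (G-⊛ n) ⟩
      (G ⊛ G) n ∎
      where
      xpp = (X· (P ⊛ P)) n
      xpv = (X· (P ⊛ V)) n
      xvv = (X· (V ⊛ V)) n

-- Quadratic equations over a commutative ring

module _ (R : CommutativeRing 0ℓ 0ℓ) where
  open CommutativeRing R
  private module S = NatSolver commutativeSemiring
  open S using (_:+_; _:*_; _:=_; con)
  open RingProps ring using (+-cancelʳ; x≈z//y)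
  open SetoidReasoning setoid

  -- F, Q and S belong to the paths whose first ascent is prolonged by 0, 1 and at least 2 steps.
  eliminate-runs : ∀ u t F Q S → F ≈ 1# + u * (Q * F) → Q ≈ 1# + u * (S * F) → S ≈ t + u * (S * F) →
              F + u * (u * (F * F)) ≈ 1# + (u * (F * F) + t * (u * (u * (F * F))))
  eliminate-runs u t F Q S hF hQ hS = begin
    F + u * (u * (F * F))                   ≈⟨ +-congʳ hF ⟩
    (1# + u * (Q * F)) + u * (u * (F * F))
      ≈⟨ S.solve 3 (λ u F Q → (con 1 :+ u :* (Q :* F)) :+ u :* (u :* (F :* F)) := con 1 :+ (u :* F) :* (Q :+ u :* F)) refl u F Q ⟩
    1# + (u * F) * (Q + u * F)              ≈⟨ +-congˡ (*-congˡ key) ⟩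
    1# + (u * F) * (F + t * (u * F))
      ≈⟨ S.solve 3 (λ u t F → con 1 :+ (u :* F) :* (F :+ t :* (u :* F)) := con 1 :+ (u :* (F :* F) :+ t :* (u :* (u :* (F :* F))))) refl u t F ⟩
    1# + (u * (F * F) + t * (u * (u * (F * F)))) ∎
    where
    -- `hQ` and `hS` share the term u·S·F, so 1 + S = t + Q; this eliminates `S`.
    key : Q + u * F ≈ F + t * (u * F)
    key = begin
      Q + u * F                         ≈⟨ +-congʳ hQ ⟩
      (1# + u * (S * F)) + u * F
        ≈⟨ S.solve 3 (λ u S F → (con 1 :+ u :* (S :* F)) :+ u :* F := con 1 :+ (u :* F) :* (con 1 :+ S)) refl u S F ⟩
      1# + (u * F) * (1# + S)           ≈⟨ +-congˡ (*-congˡ (trans (+-congˡ hS)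
         (S.solve 3 (λ t u sf → con 1 :+ (t :+ u :* sf) := t :+ (con 1 :+ u :* sf)) refl t u (S * F)))) ⟩
      1# + (u * F) * (t + (1# + u * (S * F))) ≈⟨ +-congˡ (*-congˡ (+-congˡ (sym hQ))) ⟩
      1# + (u * F) * (t + Q)
        ≈⟨ S.solve 4 (λ u t F Q → con 1 :+ (u :* F) :* (t :+ Q) := (con 1 :+ u :* (Q :* F)) :+ t :* (u :* F)) refl u t F Q ⟩
      (1# + u * (Q * F)) + t * (u * F)  ≈⟨ +-congʳ (sym hF) ⟩
      F + t * (u * F)                   ∎

  -- Multiplied by u, the equation reads φ + uφ² = u + (1 + tu)φ² for φ = uF, and uφ² = u(uF)²
  -- cancels because w + u = 1 + tu.
  shifted-quadratic : ∀ u t F → let w = (1# - u) + t * u in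
    F + u * (u * (F * F)) ≈ 1# + (u * (F * F) + t * (u * (u * (F * F)))) → u * F ≈ u + w * ((u * F) * (u * F))
  shifted-quadratic u t F hF = +-cancelʳ (u * (φ * φ)) φ (u + w * (φ * φ)) (begin
    φ + u * (φ * φ)
      ≈⟨ S.solve 2 (λ u F → u :* F :+ u :* ((u :* F) :* (u :* F)) := u :* (F :+ u :* (u :* (F :* F)))) refl u F ⟩
    u * (F + u * (u * (F * F)))                                    ≈⟨ *-congˡ hF ⟩
    u * (1# + (u * (F * F) + t * (u * (u * (F * F)))))
      ≈⟨ S.solve 3 (λ u t F → u :* (con 1 :+ (u :* (F :* F) :+ t :* (u :* (u :* (F :* F)))))
                            := u :+ (con 1 :+ t :* u) :* ((u :* F) :* (u :* F))) refl u t F ⟩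
    u + (1# + t * u) * (φ * φ)                                     ≈⟨ +-congˡ (*-congʳ (sym hw)) ⟩
    u + (w + u) * (φ * φ)
      ≈⟨ S.solve 3 (λ u w p → u :+ (w :+ u) :* p := (u :+ w :* p) :+ u :* p) refl u w (φ * φ) ⟩
    (u + w * (φ * φ)) + u * (φ * φ) ∎)
    where
    w = (1# - u) + t * u
    φ = u * F
    hw : w + u ≈ 1# + t * u
    hw = trans (S.solve 4 (λ one m x u → ((one :+ m) :+ x) :+ u := (one :+ x) :+ (m :+ u)) refl 1# (- u) (t * u) u)
               (trans (+-congˡ (-‿inverseˡ u)) (+-identityʳ _))

  -- Completing the square: r = 1 - 2q for q = wφ, and q = wu + q², so r² = 1 - 4(q - q²) = 1 - 4uw.
  discriminant : ∀ u w φ r → φ ≈ u + w * (φ * φ) → r + ((1# + 1#) * w) * φ ≈ 1# →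
                 r * r ≈ 1# - (1# + 1# + (1# + 1#)) * (u * w)
  discriminant u w φ r hφ hr = x≈z//y (r * r) (four * (u * w)) 1#
    (+-cancelʳ (four * (q * q)) (r * r + four * (u * w)) 1# (begin
      (r * r + four * (u * w)) + four * (q * q)
        ≈⟨ S.solve 4 (λ r u w q → (r :* r :+ (con 1 :+ con 1 :+ (con 1 :+ con 1)) :* (u :* w)) :+ (con 1 :+ con 1 :+ (con 1 :+ con 1)) :* (q :* q)
                                := r :* r :+ (con 1 :+ con 1 :+ (con 1 :+ con 1)) :* (w :* u :+ q :* q)) refl r u w q ⟩
      r * r + four * (w * u + q * q)                ≈⟨ +-congˡ (*-congˡ (sym hq)) ⟩
      r * r + four * q                              ≈⟨ +-congˡ (trans (sym (*-identityʳ _)) (*-congˡ (sym hr))) ⟩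
      r * r + four * q * (r + ((1# + 1#) * w) * φ)
        ≈⟨ S.solve 3 (λ r w φ → r :* r :+ (con 1 :+ con 1 :+ (con 1 :+ con 1)) :* (w :* φ) :* (r :+ ((con 1 :+ con 1) :* w) :* φ)
             := (r :+ ((con 1 :+ con 1) :* w) :* φ) :* (r :+ ((con 1 :+ con 1) :* w) :* φ)
                :+ (con 1 :+ con 1 :+ (con 1 :+ con 1)) :* ((w :* φ) :* (w :* φ))) refl r w φ ⟩
      (r + ((1# + 1#) * w) * φ) * (r + ((1# + 1#) * w) * φ) + four * (q * q)
        ≈⟨ +-congʳ (trans (*-cong hr hr) (*-identityˡ 1#)) ⟩
      1# + four * (q * q) ∎))
    where
    four = 1# + 1# + (1# + 1#)
    q = w * φ
    hq : q ≈ w * u + q * q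
    hq = trans (*-congˡ hφ) (S.solve 3 (λ u w φ → w :* (u :+ w :* (φ :* φ)) := w :* u :+ (w :* φ) :* (w :* φ)) refl u w φ)

open import Relation.Binary.PropositionalEquality

-- Dyck paths

-- ℤ[[t]] and ℤ[[t]][[u]]. Polynomials enter through `coeff`, under which `_≈P_` is definitionally
-- `A._≋_`.
module A  = PowerSeries ℤP.+-*-commutativeRing
module AA = PowerSeries A.ring′
module AR  = CommutativeRing A.ring′
module AAR = CommutativeRing AA.ring′

1A tA bA : A.Series
1A = AR.1#
tA = A.X· 1A
bA = tA A.⊕ (A.⊖ 1A)

count : {X : Set} → (X → Bool) → List X → ℕ
count p xs = length (filterᵇ p xs)

count-cong : {X : Set} {p q : X → Bool} → (∀ x → p x ≡ q x) → ∀ xs → count p xs ≡ count q xs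
count-cong h []       = refl
count-cong {p = p} {q} h (x ∷ xs) with p x | q x | h x
... | true  | _ | refl = cong suc (count-cong h xs)
... | false | _ | refl = count-cong h xs

count-none : {X : Set} {p : X → Bool} → (∀ x → p x ≡ false) → ∀ xs → count p xs ≡ 0
count-none h []       = refl
count-none {p = p} h (x ∷ xs) with p x | h x
... | false | refl = count-none h xs

count-++ : {X : Set} (p : X → Bool) → ∀ xs ys → count p (xs ++ ys) ≡ count p xs ℕ.+ count p ys
count-++ p []       ys = refl
count-++ p (x ∷ xs) ys with p x
... | true  = cong suc (count-++ p xs ys)
... | false = count-++ p xs ys

count-map : {X Y : Set} (p : X → Bool) (f : Y → X) → ∀ ys → count p (map f ys) ≡ count (p ∘ f) ys
count-map p f []       = refl
count-map p f (y ∷ ys) with p (f y)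
... | true  = cong suc (count-map p f ys)
... | false = count-map p f ys

-- Words of length L leading from height h back to 0, enumerated by their number of long ascents,
-- where the first ascent is prolonged by r steps.
paths : ℕ → ℕ → ℕ → A.Series
paths L h r k = + count (λ w → dyckFrom h w ∧ (longAscFrom r w ≡ᵇ k)) (words L)

-- The step that ends a run of `r` up steps contributes the factor t if the run is long.
mark : ℕ → A.Series → A.Series
mark (suc (suc _)) f = A.X· f
mark _             f = f

count-words-suc : ∀ p L → count p (words (suc L)) ≡ count (p ∘ (true ∷_)) (words L) ℕ.+ count (p ∘ (false ∷_)) (words L)
count-words-suc p L = trans (count-++ p (map (true ∷_) (words L)) (map (false ∷_) (words L)))
                            (cong₂ ℕ._+_ (count-map p (true ∷_) (words L)) (count-map p (false ∷_) (words L)))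

paths-suc-zero : ∀ L r → paths (suc L) 0 r A.≋ paths L 1 (suc r)
paths-suc-zero L r k = cong +_ (trans (count-words-suc _ L)
  (trans (cong (count (λ w → dyckFrom 1 w ∧ (longAscFrom (suc r) w ≡ᵇ k)) (words L) ℕ.+_)
               (count-none (λ _ → refl) (words L))) (ℕP.+-identityʳ _)))

paths-suc-suc : ∀ L h r → paths (suc L) (suc h) r A.≋ paths L (suc (suc h)) (suc r) A.⊕ mark r (paths L h 0)
paths-suc-suc L h r k = trans (cong +_ (count-words-suc _ L))
  (trans (ℤP.pos-+ (count _ (words L)) _) (cong (ℤ._+_ (paths L (suc (suc h)) (suc r) k)) (down r k)))
  where
  down : ∀ r k → + count (λ w → dyckFrom h w ∧ (endRun r ℕ.+ longAscFrom 0 w ≡ᵇ k)) (words L) ≡ mark r (paths L h 0) k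
  down zero          k       = refl
  down (suc zero)    k       = refl
  down (suc (suc r)) zero    = cong +_ (count-none (λ w → ∧-zeroʳ (dyckFrom h w)) (words L))
  down (suc (suc r)) (suc k) = refl

paths-zero-zero : ∀ r → paths 0 0 r A.≋ mark r 1A
paths-zero-zero zero          zero          = refl
paths-zero-zero zero          (suc k)       = refl
paths-zero-zero (suc zero)    zero          = refl
paths-zero-zero (suc zero)    (suc k)       = refl
paths-zero-zero (suc (suc r)) zero          = refl
paths-zero-zero (suc (suc r)) (suc zero)    = refl
paths-zero-zero (suc (suc r)) (suc (suc k)) = refl

mark-zero : ∀ r {f} → (∀ k → f k ≡ + 0) → ∀ k → mark r f k ≡ + 0
mark-zero zero          h k       = h k
mark-zero (suc zero)    h k       = h k
mark-zero (suc (suc r)) h zero    = refl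
mark-zero (suc (suc r)) h (suc k) = h k

paths-below : ∀ L h r → L < h → ∀ k → paths L h r k ≡ + 0
paths-below zero    (suc h) r _         k = refl
paths-below (suc L) (suc h) r (s≤s L<h) k = trans (paths-suc-suc L h r k)
  (cong₂ ℤ._+_ (paths-below L (suc (suc h)) (suc r) (ℕP.m<n⇒m<1+n (ℕP.m<n⇒m<1+n L<h)) k)
               (mark-zero r (paths-below L h 0 L<h) k))

longAscFrom-saturated : ∀ r w → longAscFrom (suc (suc (suc r))) w ≡ longAscFrom (suc (suc r)) w
longAscFrom-saturated r []          = refl
longAscFrom-saturated r (true ∷ w)  = longAscFrom-saturated (suc r) w
longAscFrom-saturated r (false ∷ w) = refl

-- An ascent that is already long stays long. This closes the system of equations after the run
-- lengths 0, 1 and 2.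
paths-saturated : ∀ L h r → paths L h (suc (suc (suc r))) A.≋ paths L h (suc (suc r))
paths-saturated L h r k = cong +_ (count-cong (λ w → cong (λ x → dyckFrom h w ∧ (x ≡ᵇ k)) (longAscFrom-saturated r w)) (words L))

run-suc : ∀ r → (2 ℕ.⊓ suc r) ℕ.* 2 ℕ.≤ suc (suc ((2 ℕ.⊓ r) ℕ.* 2))
run-suc zero          = ℕP.≤-refl
run-suc (suc zero)    = ℕP.≤-refl
run-suc (suc (suc r)) = ℕP.m≤n+m 4 2

-- The current run carries a credit of two letters for each of its first two up steps. An up step
-- uses one letter and adds at most two to the credit, so length plus credit grows by at most one,
-- just as the height does.
up-bound : ∀ L r → L ℕ.+ (2 ℕ.⊓ suc r) ℕ.* 2 ≤ suc (suc L ℕ.+ (2 ℕ.⊓ r) ℕ.* 2)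
up-bound L r = begin
  L ℕ.+ (2 ℕ.⊓ suc r) ℕ.* 2           ≤⟨ ℕP.+-monoʳ-≤ L (run-suc r) ⟩
  L ℕ.+ suc (suc ((2 ℕ.⊓ r) ℕ.* 2))   ≡⟨ trans (ℕP.+-suc L _) (cong suc (ℕP.+-suc L _)) ⟩
  suc (suc L ℕ.+ (2 ℕ.⊓ r) ℕ.* 2)     ∎
  where open ℕP.≤-Reasoning

-- Each long ascent uses at least two up steps, hence four steps in total.
paths-vanish : ∀ L h r k → L ℕ.+ (2 ℕ.⊓ r) ℕ.* 2 < k ℕ.* 4 ℕ.+ h → paths L h r k ≡ + 0
paths-vanish zero zero zero          (suc k)       _ = refl
paths-vanish zero zero (suc zero)    (suc k)       _ = refl
paths-vanish zero zero (suc (suc r)) (suc zero)    lt = contradiction lt (ℕP.<-irrefl refl)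
paths-vanish zero zero (suc (suc r)) (suc (suc k)) _ = refl
paths-vanish zero (suc h) r k _ = refl
paths-vanish (suc L) zero r k lt = trans (paths-suc-zero L r k) (paths-vanish L 1 (suc r) k
  (ℕP.≤-<-trans (up-bound L r) (subst (suc (suc L ℕ.+ (2 ℕ.⊓ r) ℕ.* 2) <_) (sym (ℕP.+-suc (k ℕ.* 4) 0)) (s≤s lt))))
paths-vanish (suc L) (suc h) r k lt = trans (paths-suc-suc L h r k) (cong₂ ℤ._+_
  (paths-vanish L (suc (suc h)) (suc r) k
    (ℕP.≤-<-trans (up-bound L r) (subst (suc (suc L ℕ.+ (2 ℕ.⊓ r) ℕ.* 2) <_) (sym (ℕP.+-suc (k ℕ.* 4) (suc h))) (s≤s lt))))
  (down r k lt))
  where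
  open ℕP.≤-Reasoning
  weaken : ∀ k w → suc L ℕ.+ w < k ℕ.* 4 ℕ.+ suc h → L ℕ.+ 0 < k ℕ.* 4 ℕ.+ h
  weaken k w lt = ℕP.≤-<-trans (ℕP.+-monoʳ-≤ L ℕ.z≤n) (ℕ.s<s⁻¹ (subst (suc L ℕ.+ w <_) (ℕP.+-suc (k ℕ.* 4) h) lt))
  down : ∀ r k → suc L ℕ.+ (2 ℕ.⊓ r) ℕ.* 2 < k ℕ.* 4 ℕ.+ suc h → mark r (paths L h 0) k ≡ + 0
  down zero          k       lt = paths-vanish L h 0 k (weaken k 0 lt)
  down (suc zero)    k       lt = paths-vanish L h 0 k (weaken k 2 lt)
  down (suc (suc r)) zero    lt = refl
  -- The credit 4 of the long run that ends here pays for the one long ascent removed from `k`.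
  down (suc (suc r)) (suc k) lt = paths-vanish L h 0 k (weaken k 0 (ℕP.+-cancelˡ-< 4 _ _ (begin-strict
    4 ℕ.+ (suc L ℕ.+ 0)   ≡⟨ trans (cong (4 ℕ.+_) (ℕP.+-identityʳ (suc L))) (ℕP.+-comm 4 (suc L)) ⟩
    suc L ℕ.+ 4           <⟨ lt ⟩
    4 ℕ.+ (k ℕ.* 4 ℕ.+ suc h) ∎)))

-- A path of length h + 2n from height `h` to 0 has exactly `n` up steps, so u counts up steps.
tailGF : ℕ → ℕ → AA.Series
tailGF h r n = paths (h ℕ.+ (n ℕ.+ n)) h r

dyckGF : AA.Series
dyckGF = tailGF 0 0

weight : ℕ → A.Series
weight r = mark r 1A

mark-weight : ∀ r f → mark r f A.≋ weight r A.⊛ f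
mark-weight zero          f = AR.sym (AR.*-identityˡ f)
mark-weight (suc zero)    f = AR.sym (AR.*-identityˡ f)
mark-weight (suc (suc r)) f = AR.trans (A.X·-cong (AR.sym (AR.*-identityˡ f))) (AR.sym (A.X·-⊛ 1A f))

tailGF-zero : ∀ r → tailGF 0 r AA.≋ AA.const (weight r) AA.⊕ AA.X· (tailGF 1 (suc r))
tailGF-zero r zero    = AR.trans (paths-zero-zero r) (AR.sym (AR.+-identityʳ (weight r)))
tailGF-zero r (suc n) rewrite ℕP.+-suc n n = AR.trans (paths-suc-zero (suc (n ℕ.+ n)) r) (AR.sym (AR.+-identityˡ _))

tailGF-suc : ∀ h r → tailGF (suc h) r AA.≋ weight r AA.· tailGF h 0 AA.⊕ AA.X· (tailGF (suc (suc h)) (suc r))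
tailGF-suc h r n = AR.trans (paths-suc-suc (h ℕ.+ (n ℕ.+ n)) h r)
  (AR.trans (AR.+-comm (paths (h ℕ.+ (n ℕ.+ n)) (suc (suc h)) (suc r)) (mark r (tailGF h 0 n)))
    (AR.+-cong (mark-weight r (tailGF h 0 n)) (up n)))
  where
  up : ∀ n → paths (h ℕ.+ (n ℕ.+ n)) (suc (suc h)) (suc r) A.≋ (AA.X· (tailGF (suc (suc h)) (suc r))) n
  up zero rewrite ℕP.+-identityʳ h = paths-below h (suc (suc h)) (suc r) (ℕP.m<n⇒m<1+n (ℕP.n<1+n h))
  up (suc n) k = cong (λ L → paths L (suc (suc h)) (suc r) k)
    (trans (cong (h ℕ.+_) (cong suc (ℕP.+-suc n n))) (trans (ℕP.+-suc h _) (cong suc (ℕP.+-suc h _))))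

-- Cut a path from height h + 1 at its first visit to height 0: the part before the last step there stays above height 0.
tailGF-⊛ : ∀ n h r → tailGF (suc h) r n A.≋ (tailGF h r AA.⊛ dyckGF) n
tailGF-⊛ n h r = AR.trans (tailGF-suc h r n) (AR.sym (rhs n h))
  where
  -- The recursion is lexicographic: an up step lowers `n` and may raise `h`, a down step keeps `n`
  -- and lowers `h`.
  X-part : ∀ n h → ((AA.X· (tailGF (suc h) (suc r))) AA.⊛ dyckGF) n A.≋ (AA.X· (tailGF (suc (suc h)) (suc r))) n
  X-part n h = AR.trans (AA.X·-⊛ (tailGF (suc h) (suc r)) dyckGF n) (go n)
    where
    go : ∀ n → (AA.X· (tailGF (suc h) (suc r) AA.⊛ dyckGF)) n A.≋ (AA.X· (tailGF (suc (suc h)) (suc r))) n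
    go zero    = AR.refl {AR.0#}
    go (suc n) = AR.sym (tailGF-⊛ n (suc h) (suc r))
  rhs : ∀ n h → (tailGF h r AA.⊛ dyckGF) n A.≋ (weight r AA.· tailGF h 0 AA.⊕ AA.X· (tailGF (suc (suc h)) (suc r))) n
  rhs n zero =
    AR.trans (AA.⊛-cong {g = dyckGF} (tailGF-zero r) (λ m → AR.refl {dyckGF m}) n)
    (AR.trans (AA.⊛-distribʳ dyckGF (AA.const (weight r)) (AA.X· (tailGF 1 (suc r))) n)
      (AR.+-cong (AA.const-⊛ (weight r) dyckGF n) (X-part n 0)))
  rhs n (suc h) =
    AR.trans (AA.⊛-cong {g = dyckGF} (tailGF-suc h r) (λ m → AR.refl {dyckGF m}) n)
    (AR.trans (AA.⊛-distribʳ dyckGF (weight r AA.· tailGF h 0) (AA.X· (tailGF (suc (suc h)) (suc r))) n)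
      (AR.+-cong (AR.trans (AA.·-⊛ (weight r) (tailGF h 0) dyckGF n)
                    (AR.*-congˡ {weight r} (AR.sym (tailGF-⊛ n h 0)))) (X-part n (suc h))))

module DyckQuadratic where
  open AAR using (_+_; _*_; _≈_; 1#)

  u : AA.Series
  u = AA.X· 1#

  u-⊛ : ∀ f → u * f ≈ AA.X· f
  u-⊛ f = AAR.trans (AA.X·-⊛ 1# f) (AA.X·-cong (AAR.*-identityˡ f))

  step : ∀ r → tailGF 0 r ≈ AA.const (weight r) + u * (tailGF 0 (suc r) * dyckGF)
  step r = AAR.trans (tailGF-zero r) (AAR.+-congˡ {AA.const (weight r)}
    (AAR.trans (AA.X·-cong (λ n → tailGF-⊛ n 0 (suc r))) (AAR.sym (u-⊛ (tailGF 0 (suc r) * dyckGF)))))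

  saturated : tailGF 0 3 ≈ tailGF 0 2
  saturated n = paths-saturated (n ℕ.+ n) 0 0

  t̂ : AA.Series
  t̂ = AA.const tA

  FF XFF : AA.Series
  FF  = dyckGF * dyckGF
  XFF = AA.X· FF

  dyck-quadratic : dyckGF + u * (u * FF) ≈ 1# + (u * FF + t̂ * (u * (u * FF)))
  dyck-quadratic = eliminate-runs AA.ring′ u t̂ dyckGF (tailGF 0 1) (tailGF 0 2) (step 0) (step 1)
    (AAR.trans (step 2) (AAR.+-congˡ {t̂} (AAR.*-congˡ {u} (AAR.*-congʳ {dyckGF} saturated))))

  dyck-quadratic-X : dyckGF + AA.X· XFF ≈ 1# + (XFF + tA AA.· (AA.X· XFF))
  dyck-quadratic-X = AAR.trans (AAR.+-congˡ {dyckGF} (AAR.sym uu)) (AAR.trans dyck-quadratic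
    (AAR.+-congˡ {1#} (AAR.+-cong (u-⊛ FF) (AAR.trans (AA.const-⊛ tA (u * (u * FF))) (λ n → AR.*-congˡ {tA} (uu n))))))
    where
    uu : u * (u * FF) ≈ AA.X· XFF
    uu = AAR.trans (u-⊛ (u * FF)) (AA.X·-cong (u-⊛ FF))

t≈1+b : tA A.≋ 1A A.⊕ bA
t≈1+b = AR.sym (AR.trans (AR.+-comm 1A bA) (AR.trans (AR.+-assoc tA (AR.- 1A) 1A)
  (AR.trans (AR.+-congˡ {tA} (AR.-‿inverseˡ 1A)) (AR.+-identityʳ tA))))

-- With t = 1 + b the summand u²F² on both sides of the quadratic cancels and bu²F² remains;
-- dividing by u gives the form that `Reciprocal` takes.
dyckGF-suc : AA.shift dyckGF AA.≋ dyckGF AA.⊛ dyckGF AA.⊕ bA AA.· (AA.X· (dyckGF AA.⊛ dyckGF))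
dyckGF-suc n = RP.+-cancelʳ x (dyckGF (suc n)) (ff A.⊕ bA A.⊛ x) (begin
  dyckGF (suc n) A.⊕ x                    ≈⟨ DyckQuadratic.dyck-quadratic-X (suc n) ⟩
  AR.0# A.⊕ (ff A.⊕ tA A.⊛ x)             ≈⟨ AR.+-identityˡ (ff A.⊕ tA A.⊛ x) ⟩
  ff A.⊕ tA A.⊛ x                         ≈⟨ AR.+-congˡ {ff} (AR.*-congʳ {x} t≈1+b) ⟩
  ff A.⊕ (1A A.⊕ bA) A.⊛ x
    ≈⟨ S.solve 3 (λ f b x → f S.:+ (S.con 1 S.:+ b) S.:* x S.:= (f S.:+ b S.:* x) S.:+ x) AR.refl ff bA x ⟩
  (ff A.⊕ bA A.⊛ x) A.⊕ x                 ∎)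
  where
  module RP = RingProps AR.ring
  module S = NatSolver AR.commutativeSemiring
  open SetoidReasoning AR.setoid
  ff x : A.Series
  ff = (dyckGF AA.⊛ dyckGF) n
  x  = (AA.X· (dyckGF AA.⊛ dyckGF)) n

-- Divisibility by t^(d/2).
Ord : ℕ → A.Series → Set
Ord d p = ∀ j → j ℕ.+ j < d → p j ≡ + 0

Ord-weaken : ∀ {d e p} → d ℕ.≤ e → Ord e p → Ord d p
Ord-weaken d≤e h j lt = h j (ℕP.<-≤-trans lt d≤e)

Ord-⊕ : ∀ {d p q} → Ord d p → Ord d q → Ord d (p A.⊕ q)
Ord-⊕ hp hq j lt = cong₂ ℤ._+_ (hp j lt) (hq j lt)

Ord-⊖ : ∀ {d p} → Ord d p → Ord d (A.⊖ p)
Ord-⊖ hp j lt = cong (λ x → ℤ.- x) (hp j lt)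

-- Dropping the constant coefficient of `p` lowers the doubled order `d` by two, which is why 0 and
-- 1 are separate cases.
Ord-⊛ : ∀ d e {p q} → Ord d p → Ord e q → Ord (d ℕ.+ e) (p A.⊛ q)
Ord-⊛ zero    e {p} hp hq zero lt = trans (cong (p 0 ℤ.*_) (hq 0 lt)) (ℤP.*-zeroʳ (p 0))
Ord-⊛ (suc d) e {q = q} hp hq zero lt = cong (ℤ._* q 0) (hp 0 (s≤s ℕ.z≤n))
Ord-⊛ zero e {p} {q} hp hq (suc j) lt = cong₂ ℤ._+_
  (trans (cong (p 0 ℤ.*_) (hq (suc j) lt)) (ℤP.*-zeroʳ (p 0)))
  (Ord-⊛ 0 e {A.shift p} {q} (λ _ ()) hq j (ℕP.<-trans (s≤s (ℕP.+-monoʳ-≤ j (ℕP.n≤1+n j))) lt))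
Ord-⊛ (suc zero) e {p} {q} hp hq (suc j) lt = cong₂ ℤ._+_
  (cong (ℤ._* q (suc j)) (hp 0 (s≤s ℕ.z≤n)))
  (Ord-⊛ 0 e {A.shift p} {q} (λ _ ()) hq j (ℕP.<⇒≤ (subst (λ x → suc x ℕ.≤ e) (ℕP.+-suc j j) (ℕ.s≤s⁻¹ lt))))
Ord-⊛ (suc (suc d)) e {p} {q} hp hq (suc j) lt = cong₂ ℤ._+_
  (cong (ℤ._* q (suc j)) (hp 0 (s≤s ℕ.z≤n)))
  (Ord-⊛ d e {A.shift p} {q} (λ i lt′ → hp (suc i) (s≤s (subst (_< suc d) (sym (ℕP.+-suc i i)) (s≤s lt′)))) hq j
    (subst (ℕ._≤ d ℕ.+ e) (ℕP.+-suc j j) (ℕ.s≤s⁻¹ (ℕ.s≤s⁻¹ lt))))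

-- Orders that gain half a power of t with each power of u add up in a product. Passing to
-- `AA.shift f` trades one index for one unit of `d`.
Ord-conv : ∀ n d e {f g : AA.Series} → (∀ {m} → m ℕ.≤ n → Ord (m ℕ.+ d) (f m)) → (∀ {m} → m ℕ.≤ n → Ord (m ℕ.+ e) (g m)) →
           Ord (n ℕ.+ d ℕ.+ e) ((f AA.⊛ g) n)
Ord-conv zero    d e {f} {g} hf hg = Ord-⊛ d e {f 0} {g 0} (hf ℕ.z≤n) (hg ℕ.z≤n)
Ord-conv (suc n) d e {f} {g} hf hg = Ord-⊕ {p = f 0 A.⊛ g (suc n)}
  (Ord-weaken (ℕP.≤-reflexive (trans (cong (ℕ._+ e) (ℕP.+-comm (suc n) d)) (ℕP.+-assoc d (suc n) e)))
    (Ord-⊛ d (suc n ℕ.+ e) {f 0} {g (suc n)} (hf ℕ.z≤n) (hg ℕP.≤-refl)))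
  (Ord-weaken (ℕP.≤-reflexive (cong (ℕ._+ e) (sym (ℕP.+-suc n d))))
    (Ord-conv n (suc d) e {AA.shift f} {g}
      (λ {m} m≤n → subst (λ x → Ord x (f (suc m))) (sym (ℕP.+-suc m d)) (hf (s≤s m≤n)))
      (λ m≤n → hg (ℕP.m≤n⇒m≤1+n m≤n))))

Ord-tA : ∀ {d p} → Ord d p → Ord d (tA A.⊛ p)
Ord-tA {d} {p} h j lt = trans (A.X·-⊛ 1A p j) (go j lt)
  where
  go : ∀ j → j ℕ.+ j < d → (A.X· (1A A.⊛ p)) j ≡ + 0
  go zero    lt = refl
  go (suc j) lt = trans (AR.*-identityˡ p j) (h j (ℕP.<-trans (s≤s (ℕP.+-monoʳ-≤ j (ℕP.n≤1+n j))) lt))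

Ord-bA : ∀ {d p} → Ord d p → Ord d (bA A.⊛ p)
Ord-bA {d} {p} h j lt = trans (A.⊛-distribʳ p tA (A.⊖ 1A) j)
  (cong₂ ℤ._+_ (Ord-tA h j lt) (trans (sym (RP.-‿distribˡ-* 1A p j)) (trans (cong (λ x → ℤ.- x) (AR.*-identityˡ p j)) (cong (λ x → ℤ.- x) (h j lt)))))
  where module RP = RingProps AR.ring

module G where
  open AA.Reciprocal bA dyckGF dyckGF-suc public

G-zero : G.G 0 A.≋ tA
G-zero = AR.trans (AR.+-cong {bA A.⊛ 1A} {bA} (AR.*-identityʳ bA) (paths-zero-zero 0)) (AR.trans (AR.+-comm bA 1A) (AR.sym t≈1+b))

-- By G = t + uG² - bu²G², the coefficient at m + 1 combines those of G² at m and m - 1, of doubled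
-- orders m + 4 and m + 3 by induction; m + 3 is what is required. The bound `n` makes the induction
-- a strong one.
Ord-G : ∀ n {m} → m ℕ.≤ n → Ord (m ℕ.+ 2) (G.G m)
Ord-G n       {zero}  _         zero lt = G-zero 0
Ord-G n       {zero}  _         (suc j) (s≤s (s≤s lt)) with () ← subst (ℕ._≤ 0) (ℕP.+-suc j j) lt
Ord-G (suc n) {suc m} (s≤s m≤n) j lt =
  trans (G-suc′ j) (cong₂ ℤ._+_ (GG-ord j lt) (Ord-⊖ (Ord-bA (X-ord m m≤n)) j lt))
  where
  module RP = RingProps AR.ring
  x : A.Series
  x = bA A.⊛ (AA.X· (G.G AA.⊛ G.G)) m
  G-suc′ : G.G (suc m) A.≋ (G.G AA.⊛ G.G) m A.⊕ (A.⊖ x)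
  G-suc′ = RP.x≈z//y (G.G (suc m)) x ((G.G AA.⊛ G.G) m) (G.G-suc m)
  square : ∀ m → m ℕ.≤ n → Ord (m ℕ.+ 2 ℕ.+ 2) ((G.G AA.⊛ G.G) m)
  square m m≤n = Ord-conv m 2 2 {G.G} {G.G} (λ k≤m → Ord-G n (ℕP.≤-trans k≤m m≤n)) (λ k≤m → Ord-G n (ℕP.≤-trans k≤m m≤n))
  GG-ord : Ord (suc m ℕ.+ 2) ((G.G AA.⊛ G.G) m)
  GG-ord = Ord-weaken (subst (suc m ℕ.+ 2 ℕ.≤_) (ℕP.+-comm 2 (m ℕ.+ 2)) (ℕP.n≤1+n _)) (square m m≤n)
  X-ord : ∀ m → m ℕ.≤ n → Ord (suc m ℕ.+ 2) ((AA.X· (G.G AA.⊛ G.G)) m)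
  X-ord zero    _   _ _ = refl
  X-ord (suc m) m<n = Ord-weaken (ℕP.≤-reflexive (ℕP.+-comm 2 (m ℕ.+ 2))) (square m (ℕP.<⇒≤ m<n))

-- Characteristic and Kazhdan–Lusztig polynomials as sums over subsets

private module ARP = RingProps AR.ring

coeff-+P : ∀ p q → coeff (p +P q) A.≋ coeff p A.⊕ coeff q
coeff-+P []      q       k       = sym (ℤP.+-identityˡ _)
coeff-+P (a ∷ p) []      zero    = sym (ℤP.+-identityʳ _)
coeff-+P (a ∷ p) []      (suc k) = sym (ℤP.+-identityʳ _)
coeff-+P (a ∷ p) (b ∷ q) zero    = refl
coeff-+P (a ∷ p) (b ∷ q) (suc k) = coeff-+P p q k

coeff-scaleP : ∀ c p → coeff (scaleP c p) A.≋ c A.· coeff p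
coeff-scaleP c []      k       = sym (ℤP.*-zeroʳ c)
coeff-scaleP c (a ∷ p) zero    = refl
coeff-scaleP c (a ∷ p) (suc k) = coeff-scaleP c p k

coeff-negP : ∀ p → coeff (negP p) A.≋ A.⊖ coeff p
coeff-negP p k = trans (coeff-scaleP (ℤ.- (+ 1)) p k) (ℤP.-1*i≡-i (coeff p k))

coeff-*P : ∀ p q → coeff (p *P q) A.≋ coeff p A.⊛ coeff q
coeff-*P []      q k = sym (A.⊛-zeroˡ (coeff q) (λ _ → refl) k)
coeff-*P (a ∷ p) q zero    = trans (coeff-+P (scaleP a q) (+ 0 ∷ (p *P q)) 0)
  (trans (ℤP.+-identityʳ _) (coeff-scaleP a q 0))
coeff-*P (a ∷ p) q (suc k) = trans (coeff-+P (scaleP a q) (+ 0 ∷ (p *P q)) (suc k))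
  (cong₂ ℤ._+_ (coeff-scaleP a q (suc k)) (coeff-*P p q k))

coeff-take-< : ∀ {k d} p → k < d → coeff (take d p) k ≡ coeff p k
coeff-take-< {d = suc d}         []      _         = refl
coeff-take-< {zero}  {suc d} (a ∷ p) _         = refl
coeff-take-< {suc k} {suc d} (a ∷ p) (s≤s k<d) = coeff-take-< p k<d

coeff-take-≥ : ∀ {k d} p → d ≤ k → coeff (take d p) k ≡ + 0
coeff-take-≥ {d = zero}      p       _         = refl
coeff-take-≥ {d = suc d}     []      _         = refl
coeff-take-≥ {suc k} {suc d} (a ∷ p) (s≤s d≤k) = coeff-take-≥ p d≤k

guard : Bool → A.Series → A.Series
guard true  f = f
guard false f = AR.0#

guard-cong : ∀ {b b′ f g} → b ≡ b′ → (b′ ≡ true → f A.≋ g) → guard b f A.≋ guard b′ g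
guard-cong {true}  refl h = h refl
guard-cong {false} refl h = λ _ → refl

∑ : ∀ m → (Subset m → A.Series) → A.Series
∑ zero    g = g []
∑ (suc m) g = ∑ m (g ∘ (false ∷_)) A.⊕ ∑ m (g ∘ (true ∷_))

∑-cong : ∀ m {f g} → (∀ X → f X A.≋ g X) → ∑ m f A.≋ ∑ m g
∑-cong zero    h = h []
∑-cong (suc m) h = AR.+-cong (∑-cong m (λ X → h (false ∷ X))) (∑-cong m (λ X → h (true ∷ X)))

∑-zero : ∀ m {f} → (∀ X → f X A.≋ AR.0#) → ∑ m f A.≋ AR.0#
∑-zero zero    h = h []
∑-zero (suc m) h = AR.trans (AR.+-cong (∑-zero m (λ X → h (false ∷ X))) (∑-zero m (λ X → h (true ∷ X)))) (AR.+-identityʳ AR.0#)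

∑-⊕ : ∀ m f g → ∑ m (λ X → f X A.⊕ g X) A.≋ ∑ m f A.⊕ ∑ m g
∑-⊕ zero    f g = AR.refl {f [] A.⊕ g []}
∑-⊕ (suc m) f g = AR.trans (AR.+-cong (∑-⊕ m (f ∘ (false ∷_)) (g ∘ (false ∷_))) (∑-⊕ m (f ∘ (true ∷_)) (g ∘ (true ∷_))))
  (S.solve 4 (λ a b c d → (a S.:+ b) S.:+ (c S.:+ d) S.:= (a S.:+ c) S.:+ (b S.:+ d)) AR.refl
    (∑ m (f ∘ (false ∷_))) (∑ m (g ∘ (false ∷_))) (∑ m (f ∘ (true ∷_))) (∑ m (g ∘ (true ∷_))))
  where module S = NatSolver AR.commutativeSemiring

∑-⊛ : ∀ m c g → ∑ m (λ X → c A.⊛ g X) A.≋ c A.⊛ ∑ m g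
∑-⊛ zero    c g = AR.refl {c A.⊛ g []}
∑-⊛ (suc m) c g = AR.trans (AR.+-cong (∑-⊛ m c (g ∘ (false ∷_))) (∑-⊛ m c (g ∘ (true ∷_))))
  (AR.sym (A.⊛-distribˡ c (∑ m (g ∘ (false ∷_))) (∑ m (g ∘ (true ∷_)))))

pairSum : (Bool → Bool → A.Series) → A.Series
pairSum f = (f false false A.⊕ f false true) A.⊕ (f true false A.⊕ f true true)

-- The two edges of a vertex are adjacent in the edge list. A summand that factors over vertices
-- thus has a sum that factors over vertices.
∑-pair : ∀ m (f : Bool → Bool → A.Series) g h → (∀ x y X → h (x ∷ y ∷ X) A.≋ f x y A.⊛ g X) →
         ∑ (suc (suc m)) h A.≋ pairSum f A.⊛ ∑ m g
∑-pair m f g h eq = AR.trans (AR.+-cong (AR.+-cong (part false false) (part false true)) (AR.+-cong (part true false) (part true true)))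
  (S.solve 5 (λ a b c d s → (a S.:* s S.:+ b S.:* s) S.:+ (c S.:* s S.:+ d S.:* s) S.:= ((a S.:+ b) S.:+ (c S.:+ d)) S.:* s) AR.refl
    (f false false) (f false true) (f true false) (f true true) (∑ m g))
  where
  module S = NatSolver AR.commutativeSemiring
  part : ∀ x y → ∑ m (λ X → h (x ∷ y ∷ X)) A.≋ f x y A.⊛ ∑ m g
  part x y = AR.trans (∑-cong m (eq x y)) (∑-⊛ m (f x y) g)

nonempty : ∀ {m} → Subset m → Bool
nonempty []      = false
nonempty (x ∷ X) = x ∨ nonempty X

-- Restores the empty flat, which the recursion over flats of positive rank leaves out.
∑-⊥ : ∀ m g → g ⊥ A.⊕ ∑ m (λ X → guard (nonempty X) (g X)) A.≋ ∑ m g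
∑-⊥ zero    g = AR.+-identityʳ (g [])
∑-⊥ (suc m) g = AR.trans (AR.sym (AR.+-assoc (g ⊥) (∑ m (λ X → guard (nonempty X) (g (false ∷ X)))) (∑ m (g ∘ (true ∷_)))))
  (AR.+-congʳ (∑-⊥ m (g ∘ (false ∷_))))

sumOver : {X : Set} → (X → A.Series) → List X → A.Series
sumOver g []       = AR.0#
sumOver g (x ∷ xs) = g x A.⊕ sumOver g xs

coeff-sumP : {X : Set} (g : X → Poly) → ∀ xs → coeff (sumP (map g xs)) A.≋ sumOver (coeff ∘ g) xs
coeff-sumP g []       k = refl
coeff-sumP g (x ∷ xs) k = trans (coeff-+P (g x) (sumP (map g xs)) k) (cong (λ z → coeff (g x) k ℤ.+ z) (coeff-sumP g xs k))

sumOver-filterᵇ : {X : Set} (p : X → Bool) (g : X → A.Series) → ∀ xs → sumOver g (filterᵇ p xs) A.≋ sumOver (λ x → guard (p x) (g x)) xs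
sumOver-filterᵇ p g []       = λ _ → refl
sumOver-filterᵇ p g (x ∷ xs) with p x
... | true  = AR.+-congˡ {g x} (sumOver-filterᵇ p g xs)
... | false = AR.trans (sumOver-filterᵇ p g xs) (AR.sym (AR.+-identityˡ _))

sumOver-++ : {X : Set} (g : X → A.Series) → ∀ xs ys → sumOver g (xs ++ ys) A.≋ sumOver g xs A.⊕ sumOver g ys
sumOver-++ g []       ys = AR.sym (AR.+-identityˡ (sumOver g ys))
sumOver-++ g (x ∷ xs) ys = AR.trans (AR.+-congˡ {g x} (sumOver-++ g xs ys)) (AR.sym (AR.+-assoc (g x) (sumOver g xs) (sumOver g ys)))

sumOver-map : {X Y : Set} (g : Y → A.Series) (f : X → Y) → ∀ xs → sumOver g (map f xs) A.≋ sumOver (g ∘ f) xs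
sumOver-map g f []       = λ _ → refl
sumOver-map g f (x ∷ xs) = AR.+-congˡ {g (f x)} (sumOver-map g f xs)

sumOver-subsets : ∀ m g → sumOver g (subsets m) A.≋ ∑ m g
sumOver-subsets zero    g = AR.+-identityʳ (g [])
sumOver-subsets (suc m) g = AR.trans (sumOver-++ g (map (false ∷_) (subsets m)) (map (true ∷_) (subsets m)))
  (AR.+-cong (AR.trans (sumOver-map g (false ∷_) (subsets m)) (sumOver-subsets m (g ∘ (false ∷_))))
             (AR.trans (sumOver-map g (true ∷_) (subsets m)) (sumOver-subsets m (g ∘ (true ∷_)))))

monomial : ℕ → ℕ → A.Series
monomial k e = coeff (scaleP (sign k) (tpow e))

monomial-sucˡ : ∀ k e → monomial (suc k) e A.≋ A.⊖ monomial k e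
monomial-sucˡ k e j = trans (coeff-scaleP (ℤ.- sign k) (tpow e) j)
  (trans (sym (ℤP.neg-distribˡ-* (sign k) (coeff (tpow e) j))) (cong (λ x → ℤ.- x) (sym (coeff-scaleP (sign k) (tpow e) j))))

monomial-sucʳ : ∀ k e → monomial k (suc e) A.≋ A.X· (monomial k e)
monomial-sucʳ k e zero    = ℤP.*-zeroʳ (sign k)
monomial-sucʳ k e (suc j) = refl

X·≋tA : ∀ f → A.X· f A.≋ tA A.⊛ f
X·≋tA f = AR.sym (AR.trans (A.X·-⊛ 1A f) (A.X·-cong (AR.*-identityˡ f)))

monomial-* : ∀ a d k e → monomial (a ℕ.+ k) (d ℕ.+ e) A.≋ monomial a d A.⊛ monomial k e
monomial-* zero zero k e = AR.sym (AR.trans (AR.*-congʳ {monomial k e} one) (AR.*-identityˡ (monomial k e)))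
  where
  one : monomial 0 0 A.≋ 1A
  one zero    = refl
  one (suc j) = refl
monomial-* zero (suc d) k e =
  AR.trans (monomial-sucʳ k (d ℕ.+ e))
  (AR.trans (A.X·-cong (monomial-* zero d k e))
  (AR.trans (AR.sym (A.X·-⊛ (monomial 0 d) (monomial k e))) (AR.*-congʳ {monomial k e} (AR.sym (monomial-sucʳ 0 d)))))
monomial-* (suc a) d k e =
  AR.trans (monomial-sucˡ (a ℕ.+ k) (d ℕ.+ e))
  (AR.trans (AR.-‿cong (monomial-* a d k e))
  (AR.trans (ARP.-‿distribˡ-* (monomial a d) (monomial k e)) (AR.*-congʳ {monomial k e} (AR.sym (monomial-sucˡ a d)))))

coeff-charPoly : ∀ M → coeff (charPoly M) A.≋ ∑ (m M) (λ X → guard (X ⊆ᵇ E M) (monomial ∣ X ∣ (rank M ∸ rk M X)))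
coeff-charPoly M = AR.trans (coeff-sumP term (filterᵇ (_⊆ᵇ E M) (subsets (m M))))
  (AR.trans (sumOver-filterᵇ (_⊆ᵇ E M) (coeff ∘ term) (subsets (m M)))
    (sumOver-subsets (m M) _))
  where
  term : Subset (m M) → Poly
  term X = scaleP (sign ∣ X ∣) (tpow (rank M ∸ rk M X))

KLsum : ℕ → Mat → Poly
KLsum f M = sumP (map (λ F → charPoly (localize M F) *P KLfuel f (contract M F))
                      (filterᵇ (λ F → 0 <ᵇ rk M F) (flats M)))

KLterm : ℕ → (M : Mat) → Subset (m M) → A.Series
KLterm f M F = coeff (charPoly (localize M F)) A.⊛ coeff (KLfuel f (contract M F))

KLsummand : ℕ → (M : Mat) → Subset (m M) → A.Series
KLsummand f M F = guard (isFlat M F) (guard (0 <ᵇ rk M F) (KLterm f M F))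

coeff-KLsum : ∀ f M → coeff (KLsum f M) A.≋ ∑ (m M) (KLsummand f M)
coeff-KLsum f M = AR.trans (coeff-sumP term (filterᵇ pos (flats M)))
  (AR.trans (sumOver-filterᵇ pos (coeff ∘ term) (flats M))
  (AR.trans (sumOver-filterᵇ (isFlat M) (λ F → guard (pos F) (coeff (term F))) (subsets (m M)))
  (AR.trans (sumOver-subsets (m M) _)
    (∑-cong (m M) (λ F → guard-cong {isFlat M F} refl (λ _ → guard-cong {pos F} refl
      (λ _ → coeff-*P (charPoly (localize M F)) (KLfuel f (contract M F)))))))))
  where
  pos : Subset (m M) → Bool
  pos F = 0 <ᵇ rk M F
  term : Subset (m M) → Poly
  term F = charPoly (localize M F) *P KLfuel f (contract M F)

KLfuel-rank-zero : ∀ f M → rank M ≡ 0 → KLfuel (suc f) M ≡ + 1 ∷ []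
KLfuel-rank-zero f M eq rewrite eq = refl

KLfuel-rank-suc : ∀ f M r → rank M ≡ suc r → KLfuel (suc f) M ≡ negP (take ⌈ suc r /2⌉ (KLsum f M))
KLfuel-rank-suc f M r eq rewrite eq = refl

-- Minors of thagomizer matroids

-- The minors M_n/F for flats F: vertex i is free if F misses both of its edges, viaA (viaB) if F contains
-- its edge to A (to B).  When AB ∈ F, both edges of i are contracted or neither, and either mark stands for both.
data State : Set where
  free viaA viaB : State

twice : ℕ → ℕ
twice zero    = 0
twice (suc n) = suc (suc (twice n))

bit : Bool → ℕ
bit true  = 1
bit false = 0

-- As long as AB is not contracted, the rank of an edge set is the number of free vertices it meets,
-- plus one if it joins A to B. `touch` and `link` are the shares of one vertex. Once the edge to A
-- is contracted, the edge to B is parallel to AB and links by itself.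
touch : State → Bool → Bool → ℕ
touch free x y = bit (x ∨ y)
touch _    x y = 0

link : State → Bool → Bool → Bool
link free x y = x ∧ y
link viaA x y = y
link viaB x y = x

touched : ∀ {n} → Vec State n → Subset (twice n) → ℕ
touched []      []          = 0
touched (s ∷ σ) (x ∷ y ∷ X) = touch s x y ℕ.+ touched σ X

linked : ∀ {n} → Vec State n → Subset (twice n) → Bool
linked []      []          = false
linked (s ∷ σ) (x ∷ y ∷ X) = link s x y ∨ linked σ X

-- openA and openB tell the edges outside F when AB ∉ F, openAB those when AB ∈ F.
openA openB openAB : State → Bool
openA free = true
openA viaA = false
openA viaB = true
openB free = true
openB viaA = true
openB viaB = false
openAB free = true
openAB _    = false

groundT groundB : ∀ {n} → Vec State n → Subset (twice n)
groundT []      = []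
groundT (s ∷ σ) = openA s ∷ openB s ∷ groundT σ
groundB []      = []
groundB (s ∷ σ) = openAB s ∷ openAB s ∷ groundB σ

freeCount : ∀ {n} → Vec State n → ℕ
freeCount []         = 0
freeCount (free ∷ σ) = suc (freeCount σ)
freeCount (_    ∷ σ) = freeCount σ

update₁ : State → Bool → Bool → State
update₁ free true  _     = viaA
update₁ free false true  = viaB
update₁ free false false = free
update₁ s    _     _     = s

update : ∀ {n} → Vec State n → Subset (twice n) → Vec State n
update []      []          = []
update (s ∷ σ) (x ∷ y ∷ X) = update₁ s x y ∷ update σ X

-- Flats of the minors, vertex by vertex

eqᵇ : Bool → Bool → Bool
eqᵇ true  y = y
eqᵇ false y = not y

-- Conditions on a flat at one vertex: without AB, with AB, and after AB has been contracted. In the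
-- first two, a remaining edge at a vertex that is not free is parallel to AB and shares its fate;
-- in the third no such edge remains.
flat₀ flat₁ flatB : State → Bool → Bool → Bool
flat₀ free x y = not (x ∧ y)
flat₀ _    x y = not x ∧ not y
flat₁ free x y = eqᵇ x y
flat₁ viaA x y = not x ∧ y
flat₁ viaB x y = x ∧ not y
flatB free x y = eqᵇ x y
flatB _    x y = not x ∧ not y

allPairs : (State → Bool → Bool → Bool) → ∀ {n} → Vec State n → Subset (twice n) → Bool
allPairs p []      []          = true
allPairs p (s ∷ σ) (x ∷ y ∷ X) = p s x y ∧ allPairs p σ X

-- Whether a missing edge to A (to B) would raise the rank, where `κ` tells if A and B are already
-- joined.
growA growB : State → Bool → Bool → Bool → Bool
growA free x y κ = not y ∨ not κ
growA viaA x y κ = false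
growA viaB x y κ = not κ
growB free x y κ = not x ∨ not κ
growB viaA x y κ = not κ
growB viaB x y κ = false

local : ∀ {n} → Vec State n → Subset (twice n) → Subset (twice n) → Bool → Bool
local []      []            []          κ = true
local (s ∷ σ) (e₁ ∷ e₂ ∷ E) (x ∷ y ∷ G) κ =
  (not (e₁ ∧ not x) ∨ growA s x y κ) ∧ ((not (e₂ ∧ not y) ∨ growB s x y κ) ∧ local σ E G κ)

allFinᵇ : ∀ m → (Fin m → Bool) → Bool
allFinᵇ zero    p = true
allFinᵇ (suc m) p = p Fin.zero ∧ allFinᵇ m (p ∘ Fin.suc)

allᵇ-tabulate : ∀ {m} {X : Set} (p : X → Bool) (f : Fin m → X) → allᵇ p (tabulate f) ≡ allFinᵇ m (p ∘ f)
allᵇ-tabulate {zero}  p f = refl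
allᵇ-tabulate {suc m} p f = cong (p (f Fin.zero) ∧_) (allᵇ-tabulate p (f ∘ Fin.suc))

allFinᵇ-cong : ∀ m {p q : Fin m → Bool} → (∀ i → p i ≡ q i) → allFinᵇ m p ≡ allFinᵇ m q
allFinᵇ-cong zero    h = refl
allFinᵇ-cong (suc m) h = cong₂ _∧_ (h Fin.zero) (allFinᵇ-cong m (h ∘ Fin.suc))

grows : ∀ {m} → (Subset m → ℕ) → Subset m → Subset m → Fin m → Bool
grows R E G e = not (lookup E e ∧ not (lookup G e)) ∨ (R G <ᵇ R (G ∪ ⁅ e ⁆))

<ᵇ-irrefl : ∀ n → (n <ᵇ n) ≡ false
<ᵇ-irrefl zero    = refl
<ᵇ-irrefl (suc n) = <ᵇ-irrefl n

<ᵇ-suc : ∀ n → (n <ᵇ suc n) ≡ true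
<ᵇ-suc zero    = refl
<ᵇ-suc (suc n) = <ᵇ-suc n

bit-grows : ∀ κ c m → (bit (κ ∨ c) ℕ.+ m <ᵇ bit (κ ∨ true) ℕ.+ m) ≡ not (κ ∨ c)
bit-grows true  c     m = <ᵇ-irrefl m
bit-grows false true  m = <ᵇ-irrefl m
bit-grows false false m = <ᵇ-suc m

rank-grows : ∀ a k t → (a ℕ.+ (k ℕ.+ t) <ᵇ a ℕ.+ (k ℕ.+ suc t)) ≡ true
rank-grows zero    zero    t = <ᵇ-suc t
rank-grows zero    (suc k) t = rank-grows zero k t
rank-grows (suc a) k       t = rank-grows a k t

module _ {n} (σ : Vec State n) (κ : Bool) (k : ℕ) where
  rankFrom : Subset (twice n) → ℕ
  rankFrom X = bit (κ ∨ linked σ X) ℕ.+ (k ℕ.+ touched σ X)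

growsA : ∀ {n} s (σ : Vec State n) κ k y G →
  (rankFrom (s ∷ σ) κ k (false ∷ y ∷ G) <ᵇ rankFrom (s ∷ σ) κ k (true ∷ y ∷ G)) ≡ growA s false y (κ ∨ linked (s ∷ σ) (false ∷ y ∷ G))
growsA free σ κ k false G = rank-grows (bit (κ ∨ linked σ G)) k (touched σ G)
growsA free σ κ k true  G = bit-grows κ (linked σ G) (k ℕ.+ suc (touched σ G))
growsA viaA σ κ k y     G = <ᵇ-irrefl (rankFrom (viaA ∷ σ) κ k (false ∷ y ∷ G))
growsA viaB σ κ k y     G = bit-grows κ (linked σ G) (k ℕ.+ touched σ G)

growsB : ∀ {n} s (σ : Vec State n) κ k x G →
  (rankFrom (s ∷ σ) κ k (x ∷ false ∷ G) <ᵇ rankFrom (s ∷ σ) κ k (x ∷ true ∷ G)) ≡ growB s x false (κ ∨ linked (s ∷ σ) (x ∷ false ∷ G))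
growsB free σ κ k false G = rank-grows (bit (κ ∨ linked σ G)) k (touched σ G)
growsB free σ κ k true  G = bit-grows κ (linked σ G) (k ℕ.+ suc (touched σ G))
growsB viaA σ κ k x     G = bit-grows κ (linked σ G) (k ℕ.+ touched σ G)
growsB viaB σ κ k x     G = <ᵇ-irrefl (rankFrom (viaB ∷ σ) κ k (x ∷ false ∷ G))

-- Vertices interact only through the one bit saying whether A and B are joined; given that bit,
-- flatness is a condition at each vertex. `κ` and `k` collect the contributions of the vertices
-- already passed.
grows-local : ∀ {n} (σ : Vec State n) (R : Subset (twice n) → ℕ) κ k → (∀ X → R X ≡ rankFrom σ κ k X) → ∀ E G →
              allFinᵇ (twice n) (grows R E G) ≡ local σ E G (κ ∨ linked σ G)
grows-local []      R κ k hR []            []          = refl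
grows-local {suc n} (s ∷ σ) R κ k hR (e₁ ∷ e₂ ∷ E) (x ∷ y ∷ G) = cong₂ _∧_ (posA e₁ x) (cong₂ _∧_ (posB e₂ y) rest)
  where
  κ′ : Bool
  κ′ = κ ∨ (link s x y ∨ linked σ G)
  posA : ∀ e x → (not (e ∧ not x) ∨ (R (x ∷ y ∷ G) <ᵇ R ((x ∨ true) ∷ (y ∨ false) ∷ G ∪ ⊥)))
                 ≡ (not (e ∧ not x) ∨ growA s x y (κ ∨ (link s x y ∨ linked σ G)))
  posA false x     = refl
  posA true  true  = refl
  posA true  false rewrite ∨-identityʳ y | ∪-identityʳ G | hR (false ∷ y ∷ G) | hR (true ∷ y ∷ G) = growsA s σ κ k y G
  posB : ∀ e y → (not (e ∧ not y) ∨ (R (x ∷ y ∷ G) <ᵇ R ((x ∨ false) ∷ (y ∨ true) ∷ G ∪ ⊥)))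
                 ≡ (not (e ∧ not y) ∨ growB s x y (κ ∨ (link s x y ∨ linked σ G)))
  posB false y     = refl
  posB true  true  = refl
  posB true  false rewrite ∨-identityʳ x | ∪-identityʳ G | hR (x ∷ false ∷ G) | hR (x ∷ true ∷ G) = growsB s σ κ k x G
  R′ : Subset (twice n) → ℕ
  R′ X = R (x ∷ y ∷ X)
  hR′ : ∀ X → R′ X ≡ rankFrom σ (κ ∨ link s x y) (k ℕ.+ touch s x y) X
  hR′ X = trans (hR (x ∷ y ∷ X)) (cong₂ ℕ._+_ (cong bit (sym (∨-assoc κ (link s x y) (linked σ X))))
                                              (sym (ℕP.+-assoc k (touch s x y) (touched σ X))))
  rest : allFinᵇ (twice n) (λ e → not (lookup E e ∧ not (lookup G e)) ∨ (R (x ∷ y ∷ G) <ᵇ R ((x ∨ false) ∷ (y ∨ false) ∷ G ∪ ⁅ e ⁆)))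
         ≡ local σ E G κ′
  rest = trans (allFinᵇ-cong (twice n) (λ e → cong (λ z → not (lookup E e ∧ not (lookup G e)) ∨ (R (x ∷ y ∷ G) <ᵇ z))
                 (cong₂ (λ x′ y′ → R (x′ ∷ y′ ∷ G ∪ ⁅ e ⁆)) (∨-identityʳ x) (∨-identityʳ y))))
         (trans (grows-local σ R′ (κ ∨ link s x y) (k ℕ.+ touch s x y) hR′ E G)
                (cong (local σ E G) (∨-assoc κ (link s x y) (linked σ G))))

flat₁-local : ∀ {n} (σ : Vec State n) G → (G ⊆ᵇ groundT σ) ∧ local σ (groundT σ) G true ≡ allPairs flat₁ σ G
flat₁-local []         []                  = refl
flat₁-local (free ∷ σ) (false ∷ false ∷ G) = flat₁-local σ G
flat₁-local (free ∷ σ) (false ∷ true  ∷ G) = ∧-zeroʳ _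
flat₁-local (free ∷ σ) (true  ∷ false ∷ G) = ∧-zeroʳ _
flat₁-local (free ∷ σ) (true  ∷ true  ∷ G) = flat₁-local σ G
flat₁-local (viaA ∷ σ) (false ∷ false ∷ G) = ∧-zeroʳ _
flat₁-local (viaA ∷ σ) (false ∷ true  ∷ G) = flat₁-local σ G
flat₁-local (viaA ∷ σ) (true  ∷ y     ∷ G) = refl
flat₁-local (viaB ∷ σ) (false ∷ false ∷ G) = ∧-zeroʳ _
flat₁-local (viaB ∷ σ) (false ∷ true  ∷ G) = refl
flat₁-local (viaB ∷ σ) (true  ∷ false ∷ G) = flat₁-local σ G
flat₁-local (viaB ∷ σ) (true  ∷ true  ∷ G) = refl

flatB-local : ∀ {n} (σ : Vec State n) G → (G ⊆ᵇ groundB σ) ∧ local σ (groundB σ) G true ≡ allPairs flatB σ G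
flatB-local []         []                  = refl
flatB-local (free ∷ σ) (false ∷ false ∷ G) = flatB-local σ G
flatB-local (free ∷ σ) (false ∷ true  ∷ G) = ∧-zeroʳ _
flatB-local (free ∷ σ) (true  ∷ false ∷ G) = ∧-zeroʳ _
flatB-local (free ∷ σ) (true  ∷ true  ∷ G) = flatB-local σ G
flatB-local (viaA ∷ σ) (false ∷ false ∷ G) = flatB-local σ G
flatB-local (viaA ∷ σ) (false ∷ true  ∷ G) = refl
flatB-local (viaA ∷ σ) (true  ∷ y     ∷ G) = refl
flatB-local (viaB ∷ σ) (false ∷ false ∷ G) = flatB-local σ G
flatB-local (viaB ∷ σ) (false ∷ true  ∷ G) = refl
flatB-local (viaB ∷ σ) (true  ∷ y     ∷ G) = refl

flat₀-local′ : ∀ {n} (σ : Vec State n) G →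
               (G ⊆ᵇ groundT σ) ∧ (not (linked σ G) ∧ local σ (groundT σ) G false) ≡ allPairs flat₀ σ G
flat₀-local′ []         []                  = refl
flat₀-local′ (free ∷ σ) (false ∷ false ∷ G) = flat₀-local′ σ G
flat₀-local′ (free ∷ σ) (false ∷ true  ∷ G) = flat₀-local′ σ G
flat₀-local′ (free ∷ σ) (true  ∷ false ∷ G) = flat₀-local′ σ G
flat₀-local′ (free ∷ σ) (true  ∷ true  ∷ G) = ∧-zeroʳ _
flat₀-local′ (viaA ∷ σ) (false ∷ false ∷ G) = flat₀-local′ σ G
flat₀-local′ (viaA ∷ σ) (false ∷ true  ∷ G) = ∧-zeroʳ _
flat₀-local′ (viaA ∷ σ) (true  ∷ y     ∷ G) = refl
flat₀-local′ (viaB ∷ σ) (false ∷ false ∷ G) = flat₀-local′ σ G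
flat₀-local′ (viaB ∷ σ) (false ∷ true  ∷ G) = refl
flat₀-local′ (viaB ∷ σ) (true  ∷ false ∷ G) = ∧-zeroʳ _
flat₀-local′ (viaB ∷ σ) (true  ∷ true  ∷ G) = refl

-- The factor `not (linked σ G)` comes from AB, which must raise the rank; it forces the bit passed
-- to `local` to be false.
flat₀-local : ∀ {n} (σ : Vec State n) G →
              (G ⊆ᵇ groundT σ) ∧ (not (linked σ G) ∧ local σ (groundT σ) G (linked σ G)) ≡ allPairs flat₀ σ G
flat₀-local σ G = trans (cong ((G ⊆ᵇ groundT σ) ∧_) (go (linked σ G))) (flat₀-local′ σ G)
  where
  go : ∀ c → (not c ∧ local σ (groundT σ) G c) ≡ (not c ∧ local σ (groundT σ) G false)
  go true  = refl
  go false = refl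

mat : ∀ {n} → Subset (suc (twice n)) → (Subset (suc (twice n)) → ℕ) → Mat
mat {n} E rk = record { m = suc (twice n) ; E = E ; rk = rk }

-- Pointwise conditions, since the rank function of a contraction has this form only extensionally.
-- T stands for minors of thagomizer type, B for the Boolean ones.
RankT RankB : ∀ {n} → Vec State n → (Subset (suc (twice n)) → ℕ) → Set
RankT σ rk = ∀ x X → rk (x ∷ X) ≡ bit (x ∨ linked σ X) ℕ.+ touched σ X
RankB σ rk = ∀ x X → rk (x ∷ X) ≡ touched σ X

isFlat-T₁ : ∀ {n} (σ : Vec State n) rk → RankT σ rk → ∀ G → isFlat (mat (true ∷ groundT σ) rk) (true ∷ G) ≡ allPairs flat₁ σ G
isFlat-T₁ {n} σ rk h G = trans (cong ((G ⊆ᵇ groundT σ) ∧_)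
  (trans (allᵇ-tabulate (grows rk (true ∷ groundT σ) (true ∷ G)) id)
         (grows-local σ (λ X → rk (true ∷ X)) true 0 (h true) (groundT σ) G)))
  (flat₁-local σ G)

isFlat-T₀ : ∀ {n} (σ : Vec State n) rk → RankT σ rk → ∀ G → isFlat (mat (true ∷ groundT σ) rk) (false ∷ G) ≡ allPairs flat₀ σ G
isFlat-T₀ {n} σ rk h G = trans (cong ((G ⊆ᵇ groundT σ) ∧_)
  (trans (allᵇ-tabulate (grows rk (true ∷ groundT σ) (false ∷ G)) id)
         (cong₂ _∧_ AB (grows-local σ (λ X → rk (false ∷ X)) false 0 (h false) (groundT σ) G))))
  (flat₀-local σ G)
  where
  AB : (rk (false ∷ G) <ᵇ rk (true ∷ G ∪ ⊥)) ≡ not (linked σ G)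
  AB rewrite ∪-identityʳ G | h false G | h true G = bit-grows false (linked σ G) (touched σ G)

isFlat-B₀ : ∀ {n} (σ : Vec State n) rk → RankB σ rk → ∀ G → isFlat (mat (false ∷ groundB σ) rk) (false ∷ G) ≡ allPairs flatB σ G
isFlat-B₀ {n} σ rk h G = trans (cong ((G ⊆ᵇ groundB σ) ∧_)
  (trans (allᵇ-tabulate (grows rk (false ∷ groundB σ) (false ∷ G)) id)
         -- Adding one to all ranks leaves every comparison unchanged and supplies the 1 that
         -- `rankFrom` has when A and B are joined.
         (grows-local σ (λ X → suc (rk (false ∷ X))) true 0 (λ X → cong suc (h false X)) (groundB σ) G)))
  (flatB-local σ G)

-- Characteristic polynomials of the localizations

corank₁ : State → Bool → Bool → Bool → Bool → ℕ
corank₁ free g₁ g₂ x y = bit ((g₁ ∨ g₂) ∧ not (x ∨ y))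
corank₁ _    g₁ g₂ x y = 0

corank : ∀ {n} → Vec State n → Subset (twice n) → Subset (twice n) → ℕ
corank []      []            []          = 0
corank (s ∷ σ) (g₁ ∷ g₂ ∷ G) (x ∷ y ∷ X) = corank₁ s g₁ g₂ x y ℕ.+ corank σ G X

touched-corank : ∀ {n} (σ : Vec State n) G X → (X ⊆ᵇ G) ≡ true → touched σ X ℕ.+ corank σ G X ≡ touched σ G
touched-corank []         []                  []                  h = refl
touched-corank (free ∷ σ) (g₁    ∷ g₂    ∷ G) (false ∷ false ∷ X) h =
  trans (cong (touched σ X ℕ.+_) (cong (λ b → bit b ℕ.+ corank σ G X) (∧-identityʳ (g₁ ∨ g₂))))
  (trans (ℕP.+-comm (touched σ X) _) (trans (ℕP.+-assoc (bit (g₁ ∨ g₂)) _ _)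
    (cong (bit (g₁ ∨ g₂) ℕ.+_) (trans (ℕP.+-comm _ (touched σ X)) (touched-corank σ G X h)))))
touched-corank (free ∷ σ) (false ∷ true  ∷ G) (false ∷ true  ∷ X) h = cong suc (touched-corank σ G X h)
touched-corank (free ∷ σ) (true  ∷ true  ∷ G) (false ∷ true  ∷ X) h = cong suc (touched-corank σ G X h)
touched-corank (free ∷ σ) (true  ∷ g₂    ∷ G) (true  ∷ false ∷ X) h = cong suc (touched-corank σ G X h)
touched-corank (free ∷ σ) (true  ∷ true  ∷ G) (true  ∷ true  ∷ X) h = cong suc (touched-corank σ G X h)
touched-corank (viaA ∷ σ) (g₁    ∷ g₂    ∷ G) (x     ∷ y     ∷ X) h = touched-corank σ G X (∧-conicalʳ (not y ∨ g₂) _ (∧-conicalʳ (not x ∨ g₁) _ h))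
touched-corank (viaB ∷ σ) (g₁    ∷ g₂    ∷ G) (x     ∷ y     ∷ X) h = touched-corank σ G X (∧-conicalʳ (not y ∨ g₂) _ (∧-conicalʳ (not x ∨ g₁) _ h))

∸-corank : ∀ {n} (σ : Vec State n) G X → (X ⊆ᵇ G) ≡ true → touched σ G ∸ touched σ X ≡ corank σ G X
∸-corank σ G X h = trans (cong (_∸ touched σ X) (sym (touched-corank σ G X h))) (ℕP.m+n∸m≡n (touched σ X) (corank σ G X))

suc∸-corank : ∀ {n} (σ : Vec State n) G X → (X ⊆ᵇ G) ≡ true → suc (touched σ G) ∸ touched σ X ≡ suc (corank σ G X)
suc∸-corank σ G X h = trans (cong (λ z → suc z ∸ touched σ X) (sym (touched-corank σ G X h)))
  (trans (cong (_∸ touched σ X) (sym (ℕP.+-suc (touched σ X) (corank σ G X)))) (ℕP.m+n∸m≡n (touched σ X) (suc (corank σ G X))))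

-- Such a flat has at most one edge at a free vertex and none at the others, so no subset of it
-- joins A to B.
flat₀-linked : ∀ {n} (σ : Vec State n) G X → allPairs flat₀ σ G ≡ true → (X ⊆ᵇ G) ≡ true → linked σ X ≡ false
flat₀-linked []         []                  []                  hf h = refl
flat₀-linked (free ∷ σ) (g₁    ∷ g₂    ∷ G) (false ∷ false ∷ X) hf h = flat₀-linked σ G X (∧-conicalʳ (not (g₁ ∧ g₂)) _ hf) h
flat₀-linked (free ∷ σ) (false ∷ true  ∷ G) (false ∷ true  ∷ X) hf h = flat₀-linked σ G X hf h
flat₀-linked (free ∷ σ) (true  ∷ false ∷ G) (true  ∷ false ∷ X) hf h = flat₀-linked σ G X hf h
flat₀-linked (viaA ∷ σ) (false ∷ false ∷ G) (false ∷ false ∷ X) hf h = flat₀-linked σ G X hf h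
flat₀-linked (viaB ∷ σ) (false ∷ false ∷ G) (false ∷ false ∷ X) hf h = flat₀-linked σ G X hf h

guard-true : ∀ {b f} → b ≡ true → guard b f A.≋ f
guard-true refl k = refl

guard-⊛ : ∀ p q f g → guard (p ∧ q) (f A.⊛ g) A.≋ guard p f A.⊛ guard q g
guard-⊛ true  true  f g = AR.refl {f A.⊛ g}
guard-⊛ true  false f g = AR.sym (AR.zeroʳ f)
guard-⊛ false q     f g = AR.sym (AR.zeroˡ (guard q g))

ηTerm : Bool → ∀ {n} → Vec State n → Subset (twice n) → Subset (twice n) → A.Series
ηTerm κ σ G X = guard ((X ⊆ᵇ G) ∧ (κ ∨ not (linked σ X))) (monomial ∣ X ∣ (corank σ G X))

-- Möbius sums: subsets X linking A to B cancel between X and X ∪ AB when AB ∈ F, and do not occur when F is a flat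
-- without AB.  They are counted (κ = true) only in the minors in which AB is contracted.
η : Bool → ∀ {n} → Vec State n → Subset (twice n) → A.Series
η κ {n} σ G = ∑ (twice n) (ηTerm κ σ G)

η₁ : Bool → State → Bool → Bool → Bool → Bool → A.Series
η₁ κ s g₁ g₂ x y = guard (((not x ∨ g₁) ∧ (not y ∨ g₂)) ∧ (κ ∨ not (link s x y))) (monomial (bit x ℕ.+ bit y) (corank₁ s g₁ g₂ x y))

η-pair : ∀ κ {n} s (σ : Vec State n) g₁ g₂ G → η κ (s ∷ σ) (g₁ ∷ g₂ ∷ G) A.≋ pairSum (η₁ κ s g₁ g₂) A.⊛ η κ σ G
η-pair κ {n} s σ g₁ g₂ G = ∑-pair (twice n) (η₁ κ s g₁ g₂) (ηTerm κ σ G) (ηTerm κ (s ∷ σ) (g₁ ∷ g₂ ∷ G)) λ x y X →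
  AR.trans (guard-cong (bools (not x ∨ g₁) (not y ∨ g₂) (X ⊆ᵇ G) κ (link s x y) (linked σ X))
    (λ _ → AR.trans (λ k → cong (λ z → monomial z (corank₁ s g₁ g₂ x y ℕ.+ corank σ G X) k) (card x y X))
                    (monomial-* (bit x ℕ.+ bit y) (corank₁ s g₁ g₂ x y) ∣ X ∣ (corank σ G X))))
  (guard-⊛ (((not x ∨ g₁) ∧ (not y ∨ g₂)) ∧ (κ ∨ not (link s x y))) ((X ⊆ᵇ G) ∧ (κ ∨ not (linked σ X)))
           (monomial (bit x ℕ.+ bit y) (corank₁ s g₁ g₂ x y)) (monomial ∣ X ∣ (corank σ G X)))
  where
  bools : ∀ p q r κ l c → (p ∧ (q ∧ r)) ∧ (κ ∨ not (l ∨ c)) ≡ ((p ∧ q) ∧ (κ ∨ not l)) ∧ (r ∧ (κ ∨ not c))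
  bools false q     r κ     l     c = refl
  bools true  false r κ     l     c = refl
  bools true  true  r true  l     c = refl
  bools true  true  r false true  c = ∧-zeroʳ r
  bools true  true  r false false c = refl
  card : ∀ x y (X : Subset (twice n)) → ∣ x ∷ y ∷ X ∣ ≡ (bit x ℕ.+ bit y) ℕ.+ ∣ X ∣
  card false false X = refl
  card false true  X = refl
  card true  false X = refl
  card true  true  X = refl

cA : A.Series
cA = bA A.⊕ (A.⊖ 1A)

module _ where
  private
    -- The vertex factors have degree at most one in t: two coefficients are compared and all later
    -- ones vanish by computation.
    ext : ∀ {f g : A.Series} → f 0 ≡ g 0 → f 1 ≡ g 1 → (∀ k → f (suc (suc k)) ≡ g (suc (suc k))) → f A.≋ g
    ext p q r zero          = p
    ext p q r (suc zero)    = q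
    ext p q r (suc (suc k)) = r k

    pair : ∀ κ {n} s (σ : Vec State n) g₁ g₂ G {w v} → pairSum (η₁ κ s g₁ g₂) A.≋ w → η κ σ G A.≋ v →
           η κ (s ∷ σ) (g₁ ∷ g₂ ∷ G) A.≋ w A.⊛ v
    pair κ s σ g₁ g₂ G p q = AR.trans (η-pair κ s σ g₁ g₂ G) (AR.*-cong p q)

    pair-1 : ∀ κ {n} s (σ : Vec State n) g₁ g₂ G {v} → pairSum (η₁ κ s g₁ g₂) A.≋ 1A → η κ σ G A.≋ v →
           η κ (s ∷ σ) (g₁ ∷ g₂ ∷ G) A.≋ v
    pair-1 κ s σ g₁ g₂ G {v} p q = AR.trans (pair κ s σ g₁ g₂ G p q) (AR.*-identityˡ v)

  η-flat₀ : ∀ {n} (σ : Vec State n) G → allPairs flat₀ σ G ≡ true → η false σ G A.≋ (bA AA.^^ touched σ G)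
  η-flat₀ []         []                  h = ext refl refl (λ _ → refl)
  η-flat₀ (free ∷ σ) (false ∷ false ∷ G) h = pair-1 false free σ false false G (ext refl refl (λ _ → refl)) (η-flat₀ σ G h)
  η-flat₀ (free ∷ σ) (false ∷ true  ∷ G) h = pair false free σ false true G (ext refl refl (λ _ → refl)) (η-flat₀ σ G h)
  η-flat₀ (free ∷ σ) (true  ∷ false ∷ G) h = pair false free σ true false G (ext refl refl (λ _ → refl)) (η-flat₀ σ G h)
  η-flat₀ (viaA ∷ σ) (false ∷ false ∷ G) h = pair-1 false viaA σ false false G (ext refl refl (λ _ → refl)) (η-flat₀ σ G h)
  η-flat₀ (viaB ∷ σ) (false ∷ false ∷ G) h = pair-1 false viaB σ false false G (ext refl refl (λ _ → refl)) (η-flat₀ σ G h)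

  -- A touched free vertex has both its edges in the flat. The empty choice gives t, each single
  -- edge -1, and the pair is excluded as linking: t - 2.
  η-flat₁ : ∀ {n} (σ : Vec State n) G → allPairs flat₁ σ G ≡ true → η false σ G A.≋ (cA AA.^^ touched σ G)
  η-flat₁ []         []                  h = ext refl refl (λ _ → refl)
  η-flat₁ (free ∷ σ) (false ∷ false ∷ G) h = pair-1 false free σ false false G (ext refl refl (λ _ → refl)) (η-flat₁ σ G h)
  η-flat₁ (free ∷ σ) (true  ∷ true  ∷ G) h = pair false free σ true true G (ext refl refl (λ _ → refl)) (η-flat₁ σ G h)
  η-flat₁ (viaA ∷ σ) (false ∷ true  ∷ G) h = pair-1 false viaA σ false true G (ext refl refl (λ _ → refl)) (η-flat₁ σ G h)
  η-flat₁ (viaB ∷ σ) (true  ∷ false ∷ G) h = pair-1 false viaB σ true false G (ext refl refl (λ _ → refl)) (η-flat₁ σ G h)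

  -- Here the two edges of a free vertex are parallel and the pair counts as well: t - 1 - 1 + 1 = t
  -- - 1.
  η-flatB : ∀ {n} (σ : Vec State n) G → allPairs flatB σ G ≡ true → η true σ G A.≋ (bA AA.^^ touched σ G)
  η-flatB []         []                  h = ext refl refl (λ _ → refl)
  η-flatB (free ∷ σ) (false ∷ false ∷ G) h = pair-1 true free σ false false G (ext refl refl (λ _ → refl)) (η-flatB σ G h)
  η-flatB (free ∷ σ) (true  ∷ true  ∷ G) h = pair true free σ true true G (ext refl refl (λ _ → refl)) (η-flatB σ G h)
  η-flatB (viaA ∷ σ) (false ∷ false ∷ G) h = pair-1 true viaA σ false false G (ext refl refl (λ _ → refl)) (η-flatB σ G h)
  η-flatB (viaB ∷ σ) (false ∷ false ∷ G) h = pair-1 true viaB σ false false G (ext refl refl (λ _ → refl)) (η-flatB σ G h)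

⊆ᵇ-refl : ∀ {m} (X : Subset m) → (X ⊆ᵇ X) ≡ true
⊆ᵇ-refl []          = refl
⊆ᵇ-refl (true ∷ X)  = ⊆ᵇ-refl X
⊆ᵇ-refl (false ∷ X) = ⊆ᵇ-refl X

charPoly-B₀ : ∀ {n} (σ : Vec State n) E rk → RankB σ rk → ∀ G → allPairs flatB σ G ≡ true →
              coeff (charPoly (localize (mat E rk) (false ∷ G))) A.≋ (bA AA.^^ touched σ G)
charPoly-B₀ {n} σ E rk h G hf = AR.trans (coeff-charPoly (localize (mat E rk) (false ∷ G)))
  (AR.trans (AR.+-cong (∑-cong (twice n) term) (∑-zero (twice n) (λ _ _ → refl)))
  (AR.trans (AR.+-identityʳ (η true σ G)) (η-flatB σ G hf)))
  where
  term : ∀ X → guard (X ⊆ᵇ G) (monomial ∣ X ∣ (rk (false ∷ G) ∸ rk (false ∷ X)))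
             A.≋ guard ((X ⊆ᵇ G) ∧ true) (monomial ∣ X ∣ (corank σ G X))
  term X = guard-cong (sym (∧-identityʳ (X ⊆ᵇ G))) (λ e k → cong (λ z → monomial ∣ X ∣ z k)
    (trans (cong₂ _∸_ (h false G) (h false X)) (∸-corank σ G X (trans (sym (∧-identityʳ (X ⊆ᵇ G))) e))))

charPoly-T₀ : ∀ {n} (σ : Vec State n) E rk → RankT σ rk → ∀ G → allPairs flat₀ σ G ≡ true →
              coeff (charPoly (localize (mat E rk) (false ∷ G))) A.≋ (bA AA.^^ touched σ G)
charPoly-T₀ {n} σ E rk h G hf = AR.trans (coeff-charPoly (localize (mat E rk) (false ∷ G)))
  (AR.trans (AR.+-cong (∑-cong (twice n) (λ X → term X (X ⊆ᵇ G) refl)) (∑-zero (twice n) (λ _ _ → refl)))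
  (AR.trans (AR.+-identityʳ (η false σ G)) (η-flat₀ σ G hf)))
  where
  term : ∀ X b → (X ⊆ᵇ G) ≡ b → guard (X ⊆ᵇ G) (monomial ∣ X ∣ (rk (false ∷ G) ∸ rk (false ∷ X)))
             A.≋ guard ((X ⊆ᵇ G) ∧ not (linked σ X)) (monomial ∣ X ∣ (corank σ G X))
  term X false e rewrite e = λ _ → refl
  term X true  e rewrite flat₀-linked σ G X hf e | e | h false G | h false X
    | flat₀-linked σ G X hf e | flat₀-linked σ G G hf (⊆ᵇ-refl G) | ∸-corank σ G X e = λ _ → refl

charPoly-T₁ : ∀ {n} (σ : Vec State n) E rk → RankT σ rk → ∀ G → allPairs flat₁ σ G ≡ true →
              coeff (charPoly (localize (mat E rk) (true ∷ G))) A.≋ bA A.⊛ (cA AA.^^ touched σ G)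
charPoly-T₁ {n} σ E rk h G hf = AR.trans (coeff-charPoly (localize (mat E rk) (true ∷ G)))
  (AR.trans (AR.sym (∑-⊕ (twice n) (λ X → guard (X ⊆ᵇ G) (without X)) (λ X → guard (X ⊆ᵇ G) (with′ X))))
  (AR.trans (∑-cong (twice n) (λ X → term X (X ⊆ᵇ G) refl (linked σ X) refl))
  (AR.trans (∑-⊛ (twice n) bA _) (AR.*-congˡ {bA} (η-flat₁ σ G hf)))))
  where
  module P = RingProps AR.ring
  without with′ : Subset (twice n) → A.Series
  without X = monomial ∣ X ∣ (rk (true ∷ G) ∸ rk (false ∷ X))
  with′   X = monomial (suc ∣ X ∣) (rk (true ∷ G) ∸ rk (true ∷ X))
  term : ∀ X b → (X ⊆ᵇ G) ≡ b → ∀ l → linked σ X ≡ l → guard (X ⊆ᵇ G) (without X) A.⊕ guard (X ⊆ᵇ G) (with′ X)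
         A.≋ bA A.⊛ guard ((X ⊆ᵇ G) ∧ not (linked σ X)) (monomial ∣ X ∣ (corank σ G X))
  term X false e l el rewrite e = AR.trans (AR.+-identityʳ AR.0#) (AR.sym (AR.zeroʳ bA))
  -- A and B are already joined: adding AB keeps the rank and flips the sign, so the two terms
  -- cancel.
  term X true  e true el rewrite e | h true G | h false X | h true X | el =
    AR.trans (AR.+-congˡ {μ} (monomial-sucˡ ∣ X ∣ (touched σ G ∸ touched σ X)))
      (AR.trans (AR.-‿inverseʳ μ) (AR.sym (AR.zeroʳ bA)))
    where
    μ : A.Series
    μ = monomial ∣ X ∣ (touched σ G ∸ touched σ X)
  -- Otherwise AB raises the rank by one, and the two terms are tμ and -μ.
  term X true  e false el rewrite e | h true G | h false X | h true X | el | ∸-corank σ G X e | suc∸-corank σ G X e =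
    AR.trans (AR.+-cong (AR.trans (monomial-sucʳ ∣ X ∣ (corank σ G X)) (X·≋tA μ))
                        (AR.trans (monomial-sucˡ ∣ X ∣ (corank σ G X))
                          (AR.trans (AR.-‿cong (AR.sym (AR.*-identityˡ μ))) (P.-‿distribˡ-* 1A μ))))
             (AR.sym (A.⊛-distribʳ μ tA (A.⊖ 1A)))
    where
    μ : A.Series
    μ = monomial ∣ X ∣ (corank σ G X)

-- Contractions of the minors

touched-∪ : ∀ {n} (σ : Vec State n) X G → touched σ (X ∪ G) ≡ touched σ G ℕ.+ touched (update σ G) X
touched-∪ []      []          []            = refl
touched-∪ (s ∷ σ) (x ∷ y ∷ X) (g₁ ∷ g₂ ∷ G) = begin
  touch s (x ∨ g₁) (y ∨ g₂) ℕ.+ touched σ (X ∪ G)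
    ≡⟨ cong₂ ℕ._+_ (touch-∪ s x y g₁ g₂) (touched-∪ σ X G) ⟩
  (touch s g₁ g₂ ℕ.+ touch (update₁ s g₁ g₂) x y) ℕ.+ (touched σ G ℕ.+ touched (update σ G) X)
    ≡⟨ interchange (touch s g₁ g₂) _ _ _ ⟩
  (touch s g₁ g₂ ℕ.+ touched σ G) ℕ.+ (touch (update₁ s g₁ g₂) x y ℕ.+ touched (update σ G) X) ∎
  where
  open ≡-Reasoning
  open CommSemigroup ℕP.+-commutativeSemigroup using (interchange)
  touch-∪ : ∀ s x y g₁ g₂ → touch s (x ∨ g₁) (y ∨ g₂) ≡ touch s g₁ g₂ ℕ.+ touch (update₁ s g₁ g₂) x y
  touch-∪ free x     y     false false = cong bit (cong₂ _∨_ (∨-identityʳ x) (∨-identityʳ y))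
  touch-∪ free x     y     false true  = cong bit (trans (cong (_∨ (y ∨ true)) (∨-identityʳ x)) (trans (cong (x ∨_) (∨-zeroʳ y)) (∨-zeroʳ x)))
  touch-∪ free x     y     true  g₂    = cong (λ z → bit (z ∨ (y ∨ g₂))) (∨-zeroʳ x)
  touch-∪ viaA x     y     g₁    g₂    = refl
  touch-∪ viaB x     y     g₁    g₂    = refl

-- At a free vertex the flat has at most one edge, and the mark set by `update` remembers which; the
-- other edge then suffices to join A to B.
linked-∪ : ∀ {n} (σ : Vec State n) X G → allPairs flat₀ σ G ≡ true → linked σ (X ∪ G) ≡ linked (update σ G) X
linked-∪ []         []          []                  h = refl
linked-∪ (free ∷ σ) (x ∷ y ∷ X) (false ∷ false ∷ G) h = cong₂ _∨_ (cong₂ _∧_ (∨-identityʳ x) (∨-identityʳ y)) (linked-∪ σ X G h)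
linked-∪ (free ∷ σ) (x ∷ y ∷ X) (false ∷ true  ∷ G) h = cong₂ _∨_ (trans (cong ((x ∨ false) ∧_) (∨-zeroʳ y)) (trans (∧-identityʳ _) (∨-identityʳ x))) (linked-∪ σ X G h)
linked-∪ (free ∷ σ) (x ∷ y ∷ X) (true  ∷ false ∷ G) h = cong₂ _∨_ (trans (cong (_∧ (y ∨ false)) (∨-zeroʳ x)) (∨-identityʳ y)) (linked-∪ σ X G h)
linked-∪ (viaA ∷ σ) (x ∷ y ∷ X) (false ∷ false ∷ G) h = cong₂ _∨_ (∨-identityʳ y) (linked-∪ σ X G h)
linked-∪ (viaB ∷ σ) (x ∷ y ∷ X) (false ∷ false ∷ G) h = cong₂ _∨_ (∨-identityʳ x) (linked-∪ σ X G h)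

groundT-─₀ : ∀ {n} (σ : Vec State n) G → allPairs flat₀ σ G ≡ true → groundT σ ─ G ≡ groundT (update σ G)
groundT-─₀ []         []                  h = refl
groundT-─₀ (free ∷ σ) (false ∷ false ∷ G) h = cong (λ E → true ∷ true ∷ E) (groundT-─₀ σ G h)
groundT-─₀ (free ∷ σ) (false ∷ true  ∷ G) h = cong (λ E → true ∷ false ∷ E) (groundT-─₀ σ G h)
groundT-─₀ (free ∷ σ) (true  ∷ false ∷ G) h = cong (λ E → false ∷ true ∷ E) (groundT-─₀ σ G h)
groundT-─₀ (viaA ∷ σ) (false ∷ false ∷ G) h = cong (λ E → false ∷ true ∷ E) (groundT-─₀ σ G h)
groundT-─₀ (viaB ∷ σ) (false ∷ false ∷ G) h = cong (λ E → true ∷ false ∷ E) (groundT-─₀ σ G h)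

groundT-─₁ : ∀ {n} (σ : Vec State n) G → allPairs flat₁ σ G ≡ true → groundT σ ─ G ≡ groundB (update σ G)
groundT-─₁ []         []                  h = refl
groundT-─₁ (free ∷ σ) (false ∷ false ∷ G) h = cong (λ E → true ∷ true ∷ E) (groundT-─₁ σ G h)
groundT-─₁ (free ∷ σ) (true  ∷ true  ∷ G) h = cong (λ E → false ∷ false ∷ E) (groundT-─₁ σ G h)
groundT-─₁ (viaA ∷ σ) (false ∷ true  ∷ G) h = cong (λ E → false ∷ false ∷ E) (groundT-─₁ σ G h)
groundT-─₁ (viaB ∷ σ) (true  ∷ false ∷ G) h = cong (λ E → false ∷ false ∷ E) (groundT-─₁ σ G h)

groundB-─ : ∀ {n} (σ : Vec State n) G → allPairs flatB σ G ≡ true → groundB σ ─ G ≡ groundB (update σ G)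
groundB-─ []         []                  h = refl
groundB-─ (free ∷ σ) (false ∷ false ∷ G) h = cong (λ E → true ∷ true ∷ E) (groundB-─ σ G h)
groundB-─ (free ∷ σ) (true  ∷ true  ∷ G) h = cong (λ E → false ∷ false ∷ E) (groundB-─ σ G h)
groundB-─ (viaA ∷ σ) (false ∷ false ∷ G) h = cong (λ E → false ∷ false ∷ E) (groundB-─ σ G h)
groundB-─ (viaB ∷ σ) (false ∷ false ∷ G) h = cong (λ E → false ∷ false ∷ E) (groundB-─ σ G h)

freeCount-update : ∀ {n} (σ : Vec State n) G → touched σ G ℕ.+ freeCount (update σ G) ≡ freeCount σ
freeCount-update []         []                  = refl
freeCount-update (free ∷ σ) (false ∷ false ∷ G) = trans (ℕP.+-suc (touched σ G) _) (cong suc (freeCount-update σ G))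
freeCount-update (free ∷ σ) (false ∷ true  ∷ G) = cong suc (freeCount-update σ G)
freeCount-update (free ∷ σ) (true  ∷ y     ∷ G) = cong suc (freeCount-update σ G)
freeCount-update (viaA ∷ σ) (x     ∷ y     ∷ G) = freeCount-update σ G
freeCount-update (viaB ∷ σ) (x     ∷ y     ∷ G) = freeCount-update σ G

touched-groundT : ∀ {n} (σ : Vec State n) → touched σ (groundT σ) ≡ freeCount σ
touched-groundT []         = refl
touched-groundT (free ∷ σ) = cong suc (touched-groundT σ)
touched-groundT (viaA ∷ σ) = touched-groundT σ
touched-groundT (viaB ∷ σ) = touched-groundT σ

touched-groundB : ∀ {n} (σ : Vec State n) → touched σ (groundB σ) ≡ freeCount σ
touched-groundB []         = refl
touched-groundB (free ∷ σ) = cong suc (touched-groundB σ)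
touched-groundB (viaA ∷ σ) = touched-groundB σ
touched-groundB (viaB ∷ σ) = touched-groundB σ

-- Such a flat has edges at free vertices only, and each of them contributes to the rank.
flat₀-positive : ∀ {n} (σ : Vec State n) G → allPairs flat₀ σ G ≡ true → (0 <ᵇ touched σ G) ≡ nonempty G
flat₀-positive []         []                  h = refl
flat₀-positive (free ∷ σ) (false ∷ false ∷ G) h = flat₀-positive σ G h
flat₀-positive (free ∷ σ) (false ∷ true  ∷ G) h = refl
flat₀-positive (free ∷ σ) (true  ∷ y     ∷ G) h = refl
flat₀-positive (viaA ∷ σ) (false ∷ false ∷ G) h = flat₀-positive σ G h
flat₀-positive (viaB ∷ σ) (false ∷ false ∷ G) h = flat₀-positive σ G h

flatB-positive : ∀ {n} (σ : Vec State n) G → allPairs flatB σ G ≡ true → (0 <ᵇ touched σ G) ≡ nonempty G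
flatB-positive []         []                  h = refl
flatB-positive (free ∷ σ) (false ∷ false ∷ G) h = flatB-positive σ G h
flatB-positive (free ∷ σ) (true  ∷ y     ∷ G) h = refl
flatB-positive (viaA ∷ σ) (false ∷ false ∷ G) h = flatB-positive σ G h
flatB-positive (viaB ∷ σ) (false ∷ false ∷ G) h = flatB-positive σ G h

flat₀-⊥ : ∀ {n} (σ : Vec State n) → allPairs flat₀ σ ⊥ ≡ true
flat₀-⊥ []         = refl
flat₀-⊥ (free ∷ σ) = flat₀-⊥ σ
flat₀-⊥ (viaA ∷ σ) = flat₀-⊥ σ
flat₀-⊥ (viaB ∷ σ) = flat₀-⊥ σ

flatB-⊥ : ∀ {n} (σ : Vec State n) → allPairs flatB σ ⊥ ≡ true
flatB-⊥ []         = refl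
flatB-⊥ (free ∷ σ) = flatB-⊥ σ
flatB-⊥ (viaA ∷ σ) = flatB-⊥ σ
flatB-⊥ (viaB ∷ σ) = flatB-⊥ σ

touched-⊥ : ∀ {n} (σ : Vec State n) → touched σ ⊥ ≡ 0
touched-⊥ []         = refl
touched-⊥ (free ∷ σ) = touched-⊥ σ
touched-⊥ (viaA ∷ σ) = touched-⊥ σ
touched-⊥ (viaB ∷ σ) = touched-⊥ σ

-- Sums over all flats

^^-+ : ∀ c a b → (c AA.^^ (a ℕ.+ b)) A.≋ (c AA.^^ a) A.⊛ (c AA.^^ b)
^^-+ c zero    b = AR.sym (AR.*-identityˡ (c AA.^^ b))
^^-+ c (suc a) b = AR.trans (AR.*-congˡ {c} (^^-+ c a b)) (AR.sym (AR.*-assoc c (c AA.^^ a) (c AA.^^ b)))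

flatTerm : (State → Bool → Bool → Bool) → A.Series → ∀ {n} → Vec State n → Subset (twice n) → A.Series
flatTerm p c σ G = guard (allPairs p σ G) (c AA.^^ touched σ G)

-- A flat misses a free vertex or touches it in one way only, and has no choice at the other vertices.
∑-flatTerm : ∀ p c → (∀ x y → p free x y ≡ eqᵇ x y) →
             (∀ {f} → pairSum (λ x y → guard (p viaA x y) f) A.≋ f) →
             (∀ {f} → pairSum (λ x y → guard (p viaB x y) f) A.≋ f) →
             ∀ {n} (σ : Vec State n) → ∑ (twice n) (flatTerm p c σ) A.≋ ((1A A.⊕ c) AA.^^ freeCount σ)
∑-flatTerm p c pf pA pB [] = λ _ → refl
∑-flatTerm p c pf pA pB {suc n} (s ∷ σ) = AR.trans
  (∑-pair (twice n) (λ x y → guard (p s x y) (c AA.^^ touch s x y)) (flatTerm p c σ) (flatTerm p c (s ∷ σ)) term)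
  (vertex s)
  where
  term : ∀ x y X → flatTerm p c (s ∷ σ) (x ∷ y ∷ X) A.≋ guard (p s x y) (c AA.^^ touch s x y) A.⊛ flatTerm p c σ X
  term x y X = AR.trans (guard-cong {p s x y ∧ allPairs p σ X} refl (λ _ → ^^-+ c (touch s x y) (touched σ X)))
    (guard-⊛ (p s x y) (allPairs p σ X) (c AA.^^ touch s x y) (c AA.^^ touched σ X))
  vertex : ∀ s → pairSum (λ x y → guard (p s x y) (c AA.^^ touch s x y)) A.⊛ ∑ (twice n) (flatTerm p c σ)
           A.≋ ((1A A.⊕ c) AA.^^ freeCount (s ∷ σ))
  vertex free rewrite pf false false | pf false true | pf true false | pf true true =
    AR.*-cong (AR.+-cong (AR.+-identityʳ 1A) (AR.trans (AR.+-identityˡ _) (AR.*-identityʳ c))) (∑-flatTerm p c pf pA pB σ)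
  vertex viaA = AR.trans (AR.*-cong pA (∑-flatTerm p c pf pA pB σ)) (AR.*-identityˡ _)
  vertex viaB = AR.trans (AR.*-cong pB (∑-flatTerm p c pf pA pB σ)) (AR.*-identityˡ _)

forestTerm : (ℕ → A.Series) → ∀ {n} → Vec State n → Subset (twice n) → A.Series
forestTerm f σ G = guard (allPairs flat₀ σ G) ((bA AA.^^ touched σ G) A.⊛ f (freeCount (update σ G)))

only-first : ∀ x m → (x A.⊕ ∑ m (λ _ → AR.0#)) A.⊕ (∑ m (λ _ → AR.0#) A.⊕ ∑ m (λ _ → AR.0#)) A.≋ x
only-first x m = AR.trans (AR.+-cong (AR.+-congˡ {x} z) (AR.trans (AR.+-cong z z) (AR.+-identityʳ AR.0#)))
  (AR.trans (AR.+-identityʳ (x A.⊕ AR.0#)) (AR.+-identityʳ x))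
  where
  z : ∑ m (λ _ → AR.0#) A.≋ AR.0#
  z = ∑-zero m (λ _ _ → refl)

-- A free vertex either stays free, which shifts `f`, or loses one of its two edges to the flat,
-- each choice with factor b. This is the recursion of the binomial transform with parameter 2b.
∑-forestTerm : ∀ f {n} (σ : Vec State n) → ∑ (twice n) (forestTerm f σ) A.≋ AA.binomialTransform (bA A.⊕ bA) f (freeCount σ)
∑-forestTerm f [] = AR.*-identityˡ (f 0)
∑-forestTerm f {suc n} (free ∷ σ) = AR.trans
  (AR.+-cong (AR.+-cong (∑-forestTerm (λ k → f (suc k)) σ) side) (AR.+-cong side (∑-zero (twice n) (λ _ _ → refl))))
  (S.solve 3 (λ b x y → (y S.:+ b S.:* x) S.:+ (b S.:* x S.:+ S.con 0) S.:= (b S.:+ b) S.:* x S.:+ y) AR.refl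
    bA (AA.binomialTransform (bA A.⊕ bA) f (freeCount σ)) (AA.binomialTransform (bA A.⊕ bA) (λ k → f (suc k)) (freeCount σ)))
  where
  module S = NatSolver AR.commutativeSemiring
  side : ∑ (twice n) (λ G → guard (allPairs flat₀ σ G) ((bA A.⊛ (bA AA.^^ touched σ G)) A.⊛ f (freeCount (update σ G))))
         A.≋ bA A.⊛ AA.binomialTransform (bA A.⊕ bA) f (freeCount σ)
  side = AR.trans (∑-cong (twice n) (λ G → AR.trans
      (guard-cong {allPairs flat₀ σ G} refl (λ _ → AR.*-assoc bA (bA AA.^^ touched σ G) (f (freeCount (update σ G)))))
      (guard-⊛ true (allPairs flat₀ σ G) bA ((bA AA.^^ touched σ G) A.⊛ f (freeCount (update σ G))))))
    (AR.trans (∑-⊛ (twice n) bA (forestTerm f σ)) (AR.*-congˡ {bA} (∑-forestTerm f σ)))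
∑-forestTerm f {suc n} (viaA ∷ σ) = AR.trans (only-first (∑ (twice n) (forestTerm f σ)) (twice n)) (∑-forestTerm f σ)
∑-forestTerm f {suc n} (viaB ∷ σ) = AR.trans (only-first (∑ (twice n) (forestTerm f σ)) (twice n)) (∑-forestTerm f σ)

-- Solving the Kazhdan-Lusztig recursion

module ℤR = RingProps ℤP.+-*-ring

-- The recursion is solved by verification: it suffices that `q` cancels `p` below the truncation
-- degree and has no coefficients from there on.
coeff-negP-take : ∀ d p (q : A.Series) → (∀ j → j < d → coeff p j ℤ.+ q j ≡ + 0) → (∀ j → d ≤ j → q j ≡ + 0) →
                  coeff (negP (take d p)) A.≋ q
coeff-negP-take d p q low high j = trans (coeff-negP (take d p) j) (by (j ℕP.<? d))
  where
  by : Dec (j < d) → ℤ.- coeff (take d p) j ≡ q j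
  by (yes j<d) = trans (cong (λ z → ℤ.- z) (coeff-take-< p j<d)) (sym (ℤR.+-inverseʳ-unique (coeff p j) (q j) (low j j<d)))
  by (no j≮d)  = trans (cong (λ z → ℤ.- z) (coeff-take-≥ p (ℕP.≮⇒≥ j≮d))) (sym (high j (ℕP.≮⇒≥ j≮d)))

guard-comm : ∀ p q f → guard p (guard q f) A.≋ guard q (guard p f)
guard-comm true  q     f = AR.refl {guard q f}
guard-comm false true  f = λ _ → refl
guard-comm false false f = λ _ → refl

tA^^-below : ∀ n j → j < n → (tA AA.^^ n) j ≡ + 0
tA^^-below (suc n) zero    _         = sym (X·≋tA (tA AA.^^ n) 0)
tA^^-below (suc n) (suc j) (s≤s j<n) = trans (sym (X·≋tA (tA AA.^^ n) (suc j))) (tA^^-below n j j<n)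

1A-suc : ∀ j → 0 < j → 1A j ≡ + 0
1A-suc (suc j) _ = refl

∸-prefix : ∀ {a b} g u → a ≡ g ℕ.+ u → b ≡ g → a ∸ b ≡ u
∸-prefix g u refl refl = ℕP.m+n∸m≡n g u

contract-RankB : ∀ {n} (σ : Vec State n) rk → RankB σ rk → ∀ G → RankB (update σ G) (λ X → rk (X ∪ (false ∷ G)) ∸ rk (false ∷ G))
contract-RankB σ rk h G x X = ∸-prefix (touched σ G) (touched (update σ G) X)
  (trans (h (x ∨ false) (X ∪ G)) (touched-∪ σ X G)) (h false G)

contract-RankT₁ : ∀ {n} (σ : Vec State n) rk → RankT σ rk → ∀ G → RankB (update σ G) (λ X → rk (X ∪ (true ∷ G)) ∸ rk (true ∷ G))
contract-RankT₁ σ rk h G x X = ∸-prefix (suc (touched σ G)) (touched (update σ G) X)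
  (trans (h (x ∨ true) (X ∪ G)) (trans (cong (λ z → bit (z ∨ linked σ (X ∪ G)) ℕ.+ touched σ (X ∪ G)) (∨-zeroʳ x))
    (cong suc (touched-∪ σ X G)))) (h true G)

contract-RankT₀ : ∀ {n} (σ : Vec State n) rk → RankT σ rk → ∀ G → allPairs flat₀ σ G ≡ true →
                  RankT (update σ G) (λ X → rk (X ∪ (false ∷ G)) ∸ rk (false ∷ G))
contract-RankT₀ σ rk h G hf x X = ∸-prefix (touched σ G) (bit (x ∨ linked (update σ G) X) ℕ.+ touched (update σ G) X)
  (trans (h (x ∨ false) (X ∪ G)) (trans (cong₂ (λ z w → bit z ℕ.+ w) (cong₂ _∨_ (∨-identityʳ x) (linked-∪ σ X G hf)) (touched-∪ σ X G))
    (ℕ+.x∙yz≈y∙xz (bit (x ∨ linked (update σ G) X)) (touched σ G) (touched (update σ G) X))))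
  (trans (h false G) (cong (λ z → bit z ℕ.+ touched σ G) (flat₀-linked σ G G hf (⊆ᵇ-refl G))))
  where
  module ℕ+ = CommSemigroup ℕP.+-commutativeSemigroup

^^-cong : ∀ {c d} → c A.≋ d → ∀ n → (c AA.^^ n) A.≋ (d AA.^^ n)
^^-cong h zero    = AR.refl {1A}
^^-cong h (suc n) = AR.*-cong h (^^-cong h n)

update-< : ∀ {n} (σ : Vec State n) G → (0 <ᵇ touched σ G) ≡ true → freeCount (update σ G) < freeCount σ
update-< σ G pos = subst (freeCount (update σ G) <_) (freeCount-update σ G)
  (ℕP.+-monoˡ-≤ (freeCount (update σ G)) (positive (touched σ G) pos))
  where
  positive : ∀ k → (0 <ᵇ k) ≡ true → 0 < k
  positive (suc k) _ = s≤s z≤n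

freeCount-update-≤ : ∀ {n} (σ : Vec State n) G → freeCount (update σ G) ≤ freeCount σ
freeCount-update-≤ σ G = subst (freeCount (update σ G) ≤_) (freeCount-update σ G) (ℕP.m≤n+m _ (touched σ G))

∑-nonempty : ∀ m (g h : Subset m → A.Series) → (∀ X → g X A.≋ guard (nonempty X) (h X)) → ∑ m g A.⊕ h ⊥ A.≋ ∑ m h
∑-nonempty m g h eq = AR.trans (AR.+-comm (∑ m g) (h ⊥)) (AR.trans (AR.+-congˡ {h ⊥} (∑-cong m eq)) (∑-⊥ m h))

-- With ν free vertices, b to the rank summed over all flats is (1 + b)^ν = t^ν, as in a Boolean
-- lattice. For ν > 0 this vanishes below the truncation degree, so there the nonempty flats sum to
-- -1. `E` is tied by an equation because a contraction has ground set `groundB` only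
-- propositionally.
KL-B : ∀ f {n} (σ : Vec State n) E rk → E ≡ false ∷ groundB σ → RankB σ rk → freeCount σ ≤ f →
       coeff (KLfuel f (mat E rk)) A.≋ 1A
-- Without fuel the bound forces rank zero, where the default value 1 is right.
KL-B zero σ E rk hE h le = λ { zero → refl ; (suc j) → refl }
KL-B (suc f) {n} σ .(false ∷ groundB σ) rk refl h le = by (freeCount σ) refl
  where
  M : Mat
  M = mat (false ∷ groundB σ) rk
  rank-M : rank M ≡ freeCount σ
  rank-M = trans (h false (groundB σ)) (touched-groundB σ)

  KLterm-B : ∀ G → allPairs flatB σ G ≡ true → (0 <ᵇ touched σ G) ≡ true → KLterm f M (false ∷ G) A.≋ (bA AA.^^ touched σ G)
  KLterm-B G hf pos = AR.trans (AR.*-cong (charPoly-B₀ σ (false ∷ groundB σ) rk h G hf)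
      (KL-B f (update σ G) _ _ (cong (false ∷_) (groundB-─ σ G hf)) (contract-RankB σ rk h G) (ℕ.s≤s⁻¹ (ℕP.≤-trans (update-< σ G pos) le))))
    (AR.*-identityʳ (bA AA.^^ touched σ G))

  summand : ∀ G → KLsummand f M (false ∷ G)
                A.≋ guard (nonempty G) (flatTerm flatB bA σ G)
  summand G = AR.trans (guard-cong (isFlat-B₀ σ rk h G) (λ hf → guard-cong (trans (cong (0 <ᵇ_) (h false G)) (flatB-positive σ G hf))
      (λ ne → KLterm-B G hf (trans (flatB-positive σ G hf) ne))))
    (guard-comm (allPairs flatB σ G) (nonempty G) (bA AA.^^ touched σ G))

  total : coeff (KLsum f M) A.⊕ 1A A.≋ (tA AA.^^ freeCount σ)
  total = AR.trans (AR.+-cong (AR.trans (coeff-KLsum f M)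
        (AR.trans (AR.+-congˡ {∑ (twice n) (KLsummand f M ∘ (false ∷_))} (∑-zero (twice n) (λ _ _ → refl)))
                  (AR.+-identityʳ (∑ (twice n) (KLsummand f M ∘ (false ∷_))))))
      (AR.sym (AR.trans (guard-true (flatB-⊥ σ)) (λ k → cong (λ z → (bA AA.^^ z) k) (touched-⊥ σ)))))
    (AR.trans (∑-nonempty (twice n) (KLsummand f M ∘ (false ∷_)) (flatTerm flatB bA σ) summand)
    (AR.trans (∑-flatTerm flatB bA (λ _ _ → refl) unit unit σ) (^^-cong (AR.sym t≈1+b) (freeCount σ))))
    where
    unit : ∀ {f} → pairSum (λ x y → guard (not x ∧ not y) f) A.≋ f
    unit {f} = AR.trans (AR.+-congˡ {f A.⊕ AR.0#} (AR.+-identityʳ AR.0#)) (AR.trans (AR.+-identityʳ (f A.⊕ AR.0#)) (AR.+-identityʳ f))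

  by : ∀ N → freeCount σ ≡ N → coeff (KLfuel (suc f) M) A.≋ 1A
  by zero    eq rewrite KLfuel-rank-zero f M (trans rank-M eq) = λ { zero → refl ; (suc j) → refl }
  by (suc r) eq rewrite KLfuel-rank-suc f M r (trans rank-M eq) = coeff-negP-take ⌈ suc r /2⌉ (KLsum f M) 1A
    (λ j j<d → trans (total j) (trans (cong (λ z → (tA AA.^^ z) j) eq) (tA^^-below (suc r) j (ℕP.<-≤-trans j<d (ℕP.⌈n/2⌉≤n (suc r))))))
    (λ j d≤j → 1A-suc j (ℕP.<-≤-trans (s≤s z≤n) d≤j))

⌊n/2⌋-< : ∀ n j → ℕ.⌊ n /2⌋ < j → n < j ℕ.+ j
⌊n/2⌋-< zero          (suc j) _        = s≤s z≤n
⌊n/2⌋-< (suc zero)    (suc j) _        = s≤s (subst (1 ≤_) (sym (ℕP.+-suc j j)) (s≤s z≤n))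
⌊n/2⌋-< (suc (suc n)) (suc j) (s≤s lt) = s≤s (subst (suc n <_) (sym (ℕP.+-suc j j)) (s≤s (⌊n/2⌋-< n j lt)))

⌊n/2⌋-≥ : ∀ n j → j ≤ ℕ.⌊ n /2⌋ → j ℕ.+ j ≤ n
⌊n/2⌋-≥ n             zero    _        = z≤n
⌊n/2⌋-≥ (suc (suc n)) (suc j) (s≤s le) = s≤s (subst (_≤ suc n) (sym (ℕP.+-suc j j)) (s≤s (⌊n/2⌋-≥ n j le)))

dyckGF-degree : ∀ N j → ⌈ suc N /2⌉ ≤ j → dyckGF N j ≡ + 0
-- `⌈ suc N /2⌉` is definitionally the successor of `ℕ.⌊ N /2⌋`, so the hypothesis says N < 2j.
dyckGF-degree N j d≤j = paths-vanish (N ℕ.+ N) 0 0 j (begin-strict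
  N ℕ.+ N ℕ.+ 0               ≡⟨ ℕP.+-identityʳ (N ℕ.+ N) ⟩
  N ℕ.+ N                     <⟨ ℕP.+-mono-< (⌊n/2⌋-< N j d≤j) (⌊n/2⌋-< N j d≤j) ⟩
  (j ℕ.+ j) ℕ.+ (j ℕ.+ j)     ≡⟨ solve 1 (λ j → (j :+ j) :+ (j :+ j) := j :* con 4 :+ con 0) refl j ⟩
  j ℕ.* 4 ℕ.+ 0               ∎)
  where
  open ℕP.≤-Reasoning
  open +-*-Solver

-- The completed sum `G.G ν` has doubled order ν + 2, and j ≤ ⌊ν/2⌋ gives 2j < ν + 2, so it vanishes
-- throughout the range kept. Flats with AB lead to `KL-B`, other nonempty flats to fewer free
-- vertices. The fuel bound is strict because the rank is ν + 1.
KL-T : ∀ f {n} (σ : Vec State n) E rk → E ≡ true ∷ groundT σ → RankT σ rk → freeCount σ < f →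
       coeff (KLfuel f (mat E rk)) A.≋ dyckGF (freeCount σ)
KL-T (suc f) {n} σ .(true ∷ groundT σ) rk refl h (s≤s le)
  rewrite KLfuel-rank-suc f (mat (true ∷ groundT σ) rk) (freeCount σ)
            (trans (h true (groundT σ)) (cong suc (touched-groundT σ)))
  = coeff-negP-take ⌈ suc ν /2⌉ (KLsum f M) (dyckGF ν)
      (λ j j<d → trans (total j) (Ord-G ν ℕP.≤-refl j (small j j<d)))
      (dyckGF-degree ν)
  where
  ν : ℕ
  ν = freeCount σ
  M : Mat
  M = mat (true ∷ groundT σ) rk

  small : ∀ j → j < ⌈ suc ν /2⌉ → j ℕ.+ j < ν ℕ.+ 2
  small j (s≤s j≤d) = ℕP.≤-<-trans (⌊n/2⌋-≥ ν j j≤d) (ℕP.m<m+n ν (s≤s z≤n))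

  KLterm-T₁ : ∀ G → allPairs flat₁ σ G ≡ true → KLterm f M (true ∷ G) A.≋ bA A.⊛ (cA AA.^^ touched σ G)
  KLterm-T₁ G hf = AR.trans (AR.*-cong (charPoly-T₁ σ (true ∷ groundT σ) rk h G hf)
      (KL-B f (update σ G) _ _ (cong (false ∷_) (groundT-─₁ σ G hf)) (contract-RankT₁ σ rk h G)
        (ℕP.≤-trans (freeCount-update-≤ σ G) le)))
    (AR.*-identityʳ (bA A.⊛ (cA AA.^^ touched σ G)))

  KLterm-T₀ : ∀ G → allPairs flat₀ σ G ≡ true → (0 <ᵇ touched σ G) ≡ true →
              KLterm f M (false ∷ G) A.≋ (bA AA.^^ touched σ G) A.⊛ dyckGF (freeCount (update σ G))
  KLterm-T₀ G hf pos = AR.*-cong (charPoly-T₀ σ (true ∷ groundT σ) rk h G hf)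
      (KL-T f (update σ G) _ _ (cong (true ∷_) (groundT-─₀ σ G hf)) (contract-RankT₀ σ rk h G hf)
        (ℕP.≤-trans (update-< σ G pos) le))

  summand₁ : ∀ G → KLsummand f M (true ∷ G)
                 A.≋ bA A.⊛ flatTerm flat₁ cA σ G
  summand₁ G = AR.trans (guard-cong (isFlat-T₁ σ rk h G) (λ hf → AR.trans (guard-true (cong (0 <ᵇ_) (h true G))) (KLterm-T₁ G hf)))
    (guard-⊛ true (allPairs flat₁ σ G) bA (cA AA.^^ touched σ G))

  rank-F : ∀ G → allPairs flat₀ σ G ≡ true → rk (false ∷ G) ≡ touched σ G
  rank-F G hf = trans (h false G) (cong (λ z → bit z ℕ.+ touched σ G) (flat₀-linked σ G G hf (⊆ᵇ-refl G)))

  summand₀ : ∀ G → KLsummand f M (false ∷ G)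
                 A.≋ guard (nonempty G) (forestTerm dyckGF σ G)
  summand₀ G = AR.trans (guard-cong (isFlat-T₀ σ rk h G) (λ hf → guard-cong (trans (cong (0 <ᵇ_) (rank-F G hf)) (flat₀-positive σ G hf))
      (λ ne → KLterm-T₀ G hf (trans (flat₀-positive σ G hf) ne))))
    (guard-comm (allPairs flat₀ σ G) (nonempty G) _)

  -- `dyckGF ν` stands in for the term of the empty flat, whose contraction is the matroid itself.
  total : coeff (KLsum f M) A.⊕ dyckGF ν A.≋ G.G ν
  total = AR.trans (AR.+-congʳ {dyckGF ν} (coeff-KLsum f M))
    (AR.trans (S.solve 3 (λ a b d → (a S.:+ b) S.:+ d S.:= b S.:+ (a S.:+ d)) AR.refl
      (∑ (twice n) (KLsummand f M ∘ (false ∷_)))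
      (∑ (twice n) (KLsummand f M ∘ (true ∷_))) (dyckGF ν))
    (AR.+-cong flats-with-AB flats-without-AB))
    where
    module S = NatSolver AR.commutativeSemiring

    unitA : ∀ {f} → pairSum (λ x y → guard (not x ∧ y) f) A.≋ f
    unitA {f} = AR.trans (AR.+-congˡ {AR.0# A.⊕ f} (AR.+-identityʳ AR.0#)) (AR.trans (AR.+-identityʳ (AR.0# A.⊕ f)) (AR.+-identityˡ f))
    unitB : ∀ {f} → pairSum (λ x y → guard (x ∧ not y) f) A.≋ f
    unitB {f} = AR.trans (AR.+-cong (AR.+-identityʳ AR.0#) (AR.+-identityʳ f)) (AR.+-identityˡ f)

    1+c≈b : 1A A.⊕ cA A.≋ bA
    1+c≈b zero          = refl
    1+c≈b (suc zero)    = refl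
    1+c≈b (suc (suc j)) = refl

    flats-with-AB : ∑ (twice n) (KLsummand f M ∘ (true ∷_))
                    A.≋ (bA AA.^^ suc ν)
    flats-with-AB = AR.trans (∑-cong (twice n) summand₁) (AR.trans (∑-⊛ (twice n) bA (flatTerm flat₁ cA σ))
      (AR.*-congˡ {bA} (AR.trans (∑-flatTerm flat₁ cA (λ _ _ → refl) unitA unitB σ) (^^-cong 1+c≈b ν))))

    forestTerm-⊥ : forestTerm dyckGF σ ⊥ A.≋ dyckGF ν
    forestTerm-⊥ = AR.trans (guard-true (flat₀-⊥ σ)) (AR.trans
      (λ k → cong₂ (λ a b → ((bA AA.^^ a) A.⊛ dyckGF b) k) (touched-⊥ σ)
        (trans (cong (ℕ._+ freeCount (update σ ⊥)) (sym (touched-⊥ σ))) (freeCount-update σ ⊥)))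
      (AR.*-identityˡ (dyckGF ν)))

    flats-without-AB : ∑ (twice n) (KLsummand f M ∘ (false ∷_)) A.⊕ dyckGF ν
                       A.≋ AA.binomialTransform (bA A.⊕ bA) dyckGF ν
    flats-without-AB = AR.trans (AR.+-congˡ {∑ (twice n) (KLsummand f M ∘ (false ∷_))} (AR.sym forestTerm-⊥))
      (AR.trans (∑-nonempty (twice n) (KLsummand f M ∘ (false ∷_)) (forestTerm dyckGF σ) summand₀) (∑-forestTerm dyckGF σ))

-- The rank function of the thagomizer graph

⌊⌋-true : {P : Set} (d : Dec P) → P → ⌊ d ⌋ ≡ true
⌊⌋-true d p = trans (isYes≗does d) (dec-true d p)

⌊⌋-false : {P : Set} (d : Dec P) → ¬ P → ⌊ d ⌋ ≡ false
⌊⌋-false d ¬p = trans (isYes≗does d) (dec-false d ¬p)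

countFin : ∀ n → (Fin n → Bool) → ℕ
countFin zero    p = 0
countFin (suc n) p = bit (p Fin.zero) ℕ.+ countFin n (p ∘ Fin.suc)

countFin-cong : ∀ n {p q} → (∀ i → p i ≡ q i) → countFin n p ≡ countFin n q
countFin-cong zero    h = refl
countFin-cong (suc n) h = cong₂ (λ b k → bit b ℕ.+ k) (h Fin.zero) (countFin-cong n (h ∘ Fin.suc))

countFin-true : ∀ n → countFin n (λ _ → true) ≡ n
countFin-true zero    = refl
countFin-true (suc n) = cong suc (countFin-true n)

count-tabulate : ∀ {n} {X : Set} (p : X → Bool) (f : Fin n → X) → count p (tabulate f) ≡ countFin n (p ∘ f)
count-tabulate {zero}  p f = refl
count-tabulate {suc n} p f with p (f Fin.zero)
... | true  = cong suc (count-tabulate p (f ∘ Fin.suc))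
... | false = count-tabulate p (f ∘ Fin.suc)

remove : ∀ {n} → Fin n → (Fin n → Bool) → Fin n → Bool
remove i p j = p j ∧ not ⌊ i Fin.≟ j ⌋

remove-≡ : ∀ {n} (i : Fin n) p → remove i p i ≡ false
remove-≡ i p = trans (cong (λ b → p i ∧ not b) (⌊⌋-true (i Fin.≟ i) refl)) (∧-zeroʳ (p i))

remove-≢ : ∀ {n} {i j : Fin n} p → i ≢ j → remove i p j ≡ p j
remove-≢ {i = i} {j} p i≢j = trans (cong (λ b → p j ∧ not b) (⌊⌋-false (i Fin.≟ j) i≢j)) (∧-identityʳ (p j))

countFin-remove : ∀ {n} (i : Fin n) p → p i ≡ true → suc (countFin n (remove i p)) ≡ countFin n p
countFin-remove {suc n} Fin.zero p h rewrite h = cong suc (countFin-cong n (λ j → remove-≢ {i = Fin.zero} {Fin.suc j} p λ ()))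
countFin-remove {suc n} (Fin.suc i) p h = begin
  suc (bit (remove (Fin.suc i) p Fin.zero) ℕ.+ countFin n (λ j → remove (Fin.suc i) p (Fin.suc j)))
    ≡⟨ cong₂ (λ b k → suc (bit b ℕ.+ k)) (remove-≢ {i = Fin.suc i} {Fin.zero} p λ ()) (countFin-cong n shifted) ⟩
  suc (bit (p Fin.zero) ℕ.+ countFin n (remove i (p ∘ Fin.suc)))
    ≡⟨ sym (ℕP.+-suc (bit (p Fin.zero)) _) ⟩
  bit (p Fin.zero) ℕ.+ suc (countFin n (remove i (p ∘ Fin.suc)))
    ≡⟨ cong (bit (p Fin.zero) ℕ.+_) (countFin-remove i (p ∘ Fin.suc) h) ⟩
  countFin (suc n) p ∎
  where
  open ≡-Reasoning
  shifted : ∀ j → remove (Fin.suc i) p (Fin.suc j) ≡ remove i (p ∘ Fin.suc) j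
  shifted j = by (i Fin.≟ j)
    where
    by : Dec (i ≡ j) → remove (Fin.suc i) p (Fin.suc j) ≡ remove i (p ∘ Fin.suc) j
    by (yes refl) = trans (remove-≡ (Fin.suc i) p) (sym (remove-≡ i (p ∘ Fin.suc)))
    by (no i≢j)   = trans (remove-≢ p (i≢j ∘ suc-injective)) (sym (remove-≢ (p ∘ Fin.suc) i≢j))

-- The vertex set stays fixed by `N` while the induction on `n` shortens the list of spokes; `g`
-- says which spokes are left.
starEdges : ∀ {n N} → (Fin n → Fin N) → List (Fin (suc (suc N)) × Fin (suc (suc N)))
starEdges g = concatMap (λ i → (Fin.zero , Fin.suc (Fin.suc i)) ∷ (Fin.suc Fin.zero , Fin.suc (Fin.suc i)) ∷ []) (tabulate g)

length-starEdges : ∀ {n N} (g : Fin n → Fin N) → length (starEdges g) ≡ twice n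
length-starEdges {zero}  g = refl
length-starEdges {suc n} g = cong (suc ∘ suc) (length-starEdges (g ∘ Fin.suc))

subst-∷∷ : ∀ {m n} (e : m ≡ n) x y (X : Subset m) → subst Subset (cong (suc ∘ suc) e) (x ∷ y ∷ X) ≡ x ∷ y ∷ subst Subset e X
subst-∷∷ refl x y X = refl

allFree : ∀ n → Vec State n
allFree n = replicate n free

module Components {N : ℕ} where
  V : Set
  V = Fin (suc (suc N))

  vA vB : V
  vA = Fin.zero
  vB = Fin.suc Fin.zero

  spoke : Fin N → V
  spoke i = Fin.suc (Fin.suc i)

  Labelling : Set
  Labelling = V → V

  merge : Labelling → V → V → Labelling
  merge lab a b x = if ⌊ lab x Fin.≟ lab b ⌋ then lab a else lab x

  merge-≡ : ∀ lab a b {x} → lab x ≡ lab b → merge lab a b x ≡ lab a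
  merge-≡ lab a b {x} e = cong (if_then lab a else lab x) (⌊⌋-true (lab x Fin.≟ lab b) e)

  merge-≢ : ∀ lab a b {x} → lab x ≢ lab b → merge lab a b x ≡ lab x
  merge-≢ lab a b {x} ne = cong (if_then lab a else lab x) (⌊⌋-false (lab x Fin.≟ lab b) ne)

  -- The common label of joined ends depends on the edge that joined them: AB writes the label of A
  -- over that of B, an edge from B to a spoke attached to A does the opposite.
  Ends : Bool → Labelling → Set
  Ends false lab = lab vA ≡ vA × lab vB ≡ vB
  Ends true  lab = (lab vA ≡ vA × lab vB ≡ vA) ⊎ (lab vA ≡ vB × lab vB ≡ vB)

  IsEnd : V → Set
  IsEnd x = x ≡ vA ⊎ x ≡ vB

  -- Keeps just what determines the number of self-labelled vertices. Which end labels an attached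
  -- spoke is left open, since joining the ends can change it.
  record Invariant (κ : Bool) (iso : Fin N → Bool) (lab : Labelling) : Set where
    field
      ends     : Ends κ lab
      isolated : ∀ i → iso i ≡ true → lab (spoke i) ≡ spoke i
      attached : ∀ i → iso i ≡ false → IsEnd (lab (spoke i))
  open Invariant

  labA-end : ∀ κ {lab} → Ends κ lab → IsEnd (lab vA)
  labA-end false (a , b)        = inj₁ a
  labA-end true  (inj₁ (a , b)) = inj₁ a
  labA-end true  (inj₂ (a , b)) = inj₂ a

  labB-end : ∀ κ {lab} → Ends κ lab → IsEnd (lab vB)
  labB-end false (a , b)        = inj₂ b
  labB-end true  (inj₁ (a , b)) = inj₁ b
  labB-end true  (inj₂ (a , b)) = inj₂ b

  lab-end : ∀ κ {lab e} → Ends κ lab → IsEnd e → IsEnd (lab e)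
  lab-end κ h (inj₁ refl) = labA-end κ h
  lab-end κ h (inj₂ refl) = labB-end κ h

  end≢spoke : ∀ {x i} → IsEnd x → x ≢ spoke i
  end≢spoke (inj₁ refl) ()
  end≢spoke (inj₂ refl) ()

  Ends-cong : ∀ κ {lab lab′} → lab vA ≡ lab′ vA → lab vB ≡ lab′ vB → Ends κ lab → Ends κ lab′
  Ends-cong false p q (a , b)        = trans (sym p) a , trans (sym q) b
  Ends-cong true  p q (inj₁ (a , b)) = inj₁ (trans (sym p) a , trans (sym q) b)
  Ends-cong true  p q (inj₂ (a , b)) = inj₂ (trans (sym p) a , trans (sym q) b)

  module _ {κ iso lab} (inv : Invariant κ iso lab) (i : Fin N) (free-i : iso i ≡ true) where
    merge-other : ∀ e x → lab x ≢ spoke i → merge lab e (spoke i) x ≡ lab x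
    merge-other e x ne = merge-≢ lab e (spoke i) (λ eq → ne (trans eq (isolated inv i free-i)))

    merge-vA : ∀ e → merge lab e (spoke i) vA ≡ lab vA
    merge-vA e = merge-other e vA (end≢spoke (labA-end κ (ends inv)))

    merge-vB : ∀ e → merge lab e (spoke i) vB ≡ lab vB
    merge-vB e = merge-other e vB (end≢spoke (labB-end κ (ends inv)))

    attach : ∀ e → IsEnd e → Invariant κ (remove i iso) (merge lab e (spoke i))
    ends     (attach e he) = Ends-cong κ (sym (merge-vA e)) (sym (merge-vB e)) (ends inv)
    isolated (attach e he) j hj with i Fin.≟ j
    ... | yes refl = contradiction (trans (sym hj) (∧-zeroʳ (iso i))) λ ()
    ... | no i≢j   = trans (merge-other e (spoke j) (λ eq → i≢j (sym (spoke-injective (trans (sym labj) eq))))) labj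
      where
      labj : lab (spoke j) ≡ spoke j
      labj = isolated inv j (trans (sym (∧-identityʳ (iso j))) hj)
      spoke-injective : ∀ {a b} → spoke a ≡ spoke b → a ≡ b
      spoke-injective = suc-injective ∘ suc-injective
    attached (attach e he) j hj with i Fin.≟ j
    ... | yes refl = subst IsEnd (sym (merge-≡ lab e (spoke i) refl)) (lab-end κ (ends inv) he)
    ... | no i≢j   = subst IsEnd (sym (merge-other e (spoke j) (end≢spoke labj))) labj
      where
      labj : IsEnd (lab (spoke j))
      labj = attached inv j (trans (sym (∧-identityʳ (iso j))) hj)

  -- For the second edge of a spoke that already belongs to the component of A: that component takes
  -- over the label of B, which changes nothing if the ends were joined before.
  bridge : ∀ {κ iso lab} → Invariant κ iso lab → ∀ x → lab x ≡ lab vA → Invariant true iso (merge lab vB x)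
  bridge {κ} {iso} {lab} inv x hx = record
    { ends     = ends′ κ (ends inv)
    ; isolated = λ i hi → trans (merge-≢ lab vB x (λ eq → end≢spoke (labA-end κ (ends inv))
                   (sym (trans (sym (isolated inv i hi)) (trans eq hx))))) (isolated inv i hi)
    ; attached = λ i hi → merged (spoke i) (attached inv i hi) }
    where
    toA : merge lab vB x vA ≡ lab vB
    toA = merge-≡ lab vB x (sym hx)
    ends′ : ∀ κ → Ends κ lab → Ends true (merge lab vB x)
    ends′ false (a , b) = inj₂ (trans toA b ,
      trans (merge-≢ lab vB x (λ eq → contradiction (trans (sym b) (trans eq (trans hx a))) λ ())) b)
    ends′ true (inj₁ (a , b)) = inj₁ (trans toA b , trans (merge-≡ lab vB x (trans b (trans (sym a) (sym hx)))) b)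
    ends′ true (inj₂ (a , b)) = inj₂ (trans toA b , trans (merge-≡ lab vB x (trans b (trans (sym a) (sym hx)))) b)
    merged : ∀ y → IsEnd (lab y) → IsEnd (merge lab vB x y)
    merged y h with lab y Fin.≟ lab x
    ... | yes eq = labB-end κ (ends inv)
    ... | no ne  = h

  -- As `g` is injective, a spoke is still isolated when its two edges are reached. They leave it
  -- alone, attach it to one end, or attach it to A and then bridge; each attachment moves one unit
  -- from the isolated to the touched vertices.
  labels-star : ∀ {n} (g : Fin n → Fin N) → (∀ {i j} → g i ≡ g j → i ≡ j) → ∀ {κ iso lab} → Invariant κ iso lab →
    (∀ j → iso (g j) ≡ true) → ∀ (X : Subset (length (starEdges g))) →
    let Y = subst Subset (length-starEdges g) X in
    Σ (Fin N → Bool) λ iso′ → Invariant (κ ∨ linked (allFree n) Y) iso′ (labels lab (fromList (starEdges g)) X)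
                            × countFin N iso′ ℕ.+ touched (allFree n) Y ≡ countFin N iso
  labels-star {zero} g inj {κ} {iso} {lab} inv hiso [] =
    iso , subst (λ z → Invariant z iso lab) (sym (∨-identityʳ κ)) inv , ℕP.+-identityʳ _
  labels-star {suc n} g inj {κ} {iso} {lab} inv hiso (x ∷ y ∷ X)
    rewrite subst-∷∷ (length-starEdges (g ∘ Fin.suc)) x y X = go x y
    where
    i₀ : Fin N
    i₀ = g Fin.zero
    Y : Subset (twice n)
    Y = subst Subset (length-starEdges (g ∘ Fin.suc)) X
    rec : ∀ {κ iso lab} → Invariant κ iso lab → (∀ j → iso (g (Fin.suc j)) ≡ true) → _
    rec inv hiso = labels-star (g ∘ Fin.suc) (suc-injective ∘ inj) inv hiso X
    still-free : ∀ j → remove i₀ iso (g (Fin.suc j)) ≡ true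
    still-free j = trans (remove-≢ iso (λ eq → contradiction (inj eq) λ ())) (hiso (Fin.suc j))
    suc-count : ∀ {c t} → c ℕ.+ t ≡ countFin N (remove i₀ iso) → c ℕ.+ suc t ≡ countFin N iso
    suc-count {c} {t} eq = trans (ℕP.+-suc c t) (trans (cong suc eq) (countFin-remove i₀ iso (hiso Fin.zero)))
    go : ∀ x y → Σ (Fin N → Bool) λ iso′ →
         Invariant (κ ∨ ((x ∧ y) ∨ linked (allFree n) Y)) iso′ (labels lab (fromList (starEdges g)) (x ∷ y ∷ X))
         × countFin N iso′ ℕ.+ (bit (x ∨ y) ℕ.+ touched (allFree n) Y) ≡ countFin N iso
    go false false = rec inv (hiso ∘ Fin.suc)
    go false true with rec (attach inv i₀ (hiso Fin.zero) vB (inj₂ refl)) still-free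
    ... | iso′ , inv′ , eq = iso′ , inv′ , suc-count eq
    go true false with rec (attach inv i₀ (hiso Fin.zero) vA (inj₁ refl)) still-free
    ... | iso′ , inv′ , eq = iso′ , inv′ , suc-count eq
    go true true with rec (bridge (attach inv i₀ (hiso Fin.zero) vA (inj₁ refl)) (spoke i₀)
                             (trans (merge-≡ lab vA (spoke i₀) refl) (sym (merge-vA inv i₀ (hiso Fin.zero) vA)))) still-free
    ... | iso′ , inv′ , eq = iso′ , subst (λ z → Invariant z iso′ _) (sym (∨-zeroʳ κ)) inv′ , suc-count eq

  -- An attached spoke bears the label of an end, so it never represents its component.
  fixed-points : ∀ κ {iso lab} → Invariant κ iso lab →
    count (λ x → ⌊ lab x Fin.≟ x ⌋) (allFin (suc (suc N))) ≡ (if κ then 1 else 2) ℕ.+ countFin N iso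
  fixed-points κ {iso} {lab} inv = trans (count-tabulate fixed id)
    (trans (sym (ℕP.+-assoc (bit (fixed vA)) (bit (fixed vB)) _)) (cong₂ ℕ._+_ (at-ends κ (ends inv)) (countFin-cong N at-spokes)))
    where
    fixed : V → Bool
    fixed x = ⌊ lab x Fin.≟ x ⌋
    yes! : ∀ {x} → lab x ≡ x → fixed x ≡ true
    yes! {x} = ⌊⌋-true (lab x Fin.≟ x)
    no! : ∀ {x} → lab x ≢ x → fixed x ≡ false
    no! {x} = ⌊⌋-false (lab x Fin.≟ x)
    at-ends : ∀ κ → Ends κ lab → bit (fixed vA) ℕ.+ bit (fixed vB) ≡ (if κ then 1 else 2)
    at-ends false (a , b) = cong₂ (λ p q → bit p ℕ.+ bit q) (yes! a) (yes! b)
    at-ends true (inj₁ (a , b)) = cong₂ (λ p q → bit p ℕ.+ bit q) (yes! a) (no! (λ eq → contradiction (trans (sym b) eq) λ ()))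
    at-ends true (inj₂ (a , b)) = cong₂ (λ p q → bit p ℕ.+ bit q) (no! (λ eq → contradiction (trans (sym a) eq) λ ())) (yes! b)
    at-spokes : ∀ i → fixed (spoke i) ≡ iso i
    at-spokes i with iso i in eq
    ... | true  = yes! (isolated inv i eq)
    ... | false = no! (end≢spoke (attached inv i eq))

thagomizer-edges : ∀ n → length (thagEdges n) ≡ suc (twice n)
thagomizer-edges n = cong suc (length-starEdges {n} id)

subst-∷ : ∀ {m n} (e : m ≡ n) x (X : Subset m) → subst Subset (cong suc e) (x ∷ X) ≡ x ∷ subst Subset e X
subst-∷ refl x X = refl

rankT : ∀ {n} → Vec State n → Subset (suc (twice n)) → ℕ
rankT σ (x ∷ X) = bit (x ∨ linked σ X) ℕ.+ touched σ X

rk-thagomizer : ∀ n X → rk (thagomizer n) X ≡ rankT (allFree n) (subst Subset (thagomizer-edges n) X)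
rk-thagomizer n (x ∷ X) rewrite subst-∷ (length-starEdges {n} id) x X = go x
  where
  open Components {n}
  Y : Subset (twice n)
  Y = subst Subset (length-starEdges {n} id) X
  start : ∀ x → Invariant x (λ _ → true) (if x then merge id vA vB else id)
  start true  = record { ends = inj₁ (refl , refl) ; isolated = λ _ _ → refl ; attached = λ _ () }
  start false = record { ends = refl , refl ; isolated = λ _ _ → refl ; attached = λ _ () }
  rank-nullity : ∀ κ c t → c ℕ.+ t ≡ n → suc (suc n) ∸ ((if κ then 1 else 2) ℕ.+ c) ≡ bit κ ℕ.+ t
  rank-nullity true  c t refl = trans (cong (_∸ c) (sym (ℕP.+-suc c t))) (ℕP.m+n∸m≡n c (suc t))
  rank-nullity false c t refl = ℕP.m+n∸m≡n c t
  go : ∀ x → suc (suc n) ∸ components (fromList (thagEdges n)) (x ∷ X) ≡ bit (x ∨ linked (allFree n) Y) ℕ.+ touched (allFree n) Y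
  go true with labels-star id id (start true) (λ _ → refl) X
  ... | iso , inv , eq = trans (cong (suc (suc n) ∸_) (fixed-points true inv))
                               (rank-nullity true (countFin n iso) (touched (allFree n) Y) (trans eq (countFin-true n)))
  go false with labels-star id id (start false) (λ _ → refl) X
  ... | iso , inv , eq = trans (cong (suc (suc n) ∸_) (fixed-points (linked (allFree n) Y) inv))
                               (rank-nullity (linked (allFree n) Y) (countFin n iso) (touched (allFree n) Y) (trans eq (countFin-true n)))

groundT-allFree : ∀ n → ⊤ ≡ groundT (allFree n)
groundT-allFree zero    = refl
groundT-allFree (suc n) = cong (λ E → true ∷ true ∷ E) (groundT-allFree n)

freeCount-allFree : ∀ n → freeCount (allFree n) ≡ n
freeCount-allFree zero    = refl
freeCount-allFree (suc n) = cong suc (freeCount-allFree n)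

-- The number of edges is `suc (twice n)` only propositionally; with `m` a variable the equation can
-- be matched with `refl`.
KL-T-cast : ∀ {m} n (e : m ≡ suc (twice n)) (rk : Subset m → ℕ) → (∀ X → rk X ≡ rankT (allFree n) (subst Subset e X)) →
            coeff (KL (record { m = m ; E = ⊤ ; rk = rk })) A.≋ dyckGF n
KL-T-cast n refl rk h = subst (λ k → coeff (KL (mat ⊤ rk)) A.≋ dyckGF k) (freeCount-allFree n)
  (KL-T (rk ⊤) (allFree n) ⊤ rk (cong (true ∷_) (groundT-allFree n)) (λ x X → h (x ∷ X)) (ℕP.≤-reflexive (sym rank-⊤)))
  where
  rank-⊤ : rk ⊤ ≡ suc (freeCount (allFree n))
  rank-⊤ = trans (h ⊤) (cong suc (trans (cong (touched (allFree n)) (groundT-allFree n)) (touched-groundT (allFree n))))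

coeff-Pthag : ∀ n → coeff (Pthag n) A.≋ dyckGF n
coeff-Pthag n = KL-T-cast n (thagomizer-edges n) (rk (thagomizer n)) (rk-thagomizer n)

-- The generating function

-- A translation under which `_≈S_` is definitionally equality in ℤ[[t]][[u]]; the lemmas below make
-- it respect the operations.
⟦_⟧ : Ser → AA.Series
⟦ f ⟧ j = coeff (f j)

⟦+⟧ : ∀ f g → ⟦ f +S g ⟧ AAR.≈ ⟦ f ⟧ AAR.+ ⟦ g ⟧
⟦+⟧ f g j = coeff-+P (f j) (g j)

⟦-⟧ : ∀ f g → ⟦ f -S g ⟧ AAR.≈ ⟦ f ⟧ AAR.- ⟦ g ⟧
⟦-⟧ f g j = AR.trans (coeff-+P (f j) (negP (g j))) (AR.+-congˡ {coeff (f j)} (coeff-negP (g j)))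

⟦*⟧ : ∀ f g → ⟦ f *S g ⟧ AAR.≈ ⟦ f ⟧ AAR.* ⟦ g ⟧
⟦*⟧ f g j = AR.trans (λ k → cong (λ ps → coeff (sumP ps) k) (map-applyUpTo id (λ i → f i *P g (j ∸ i)) (suc j))) (go j f)
  where
  go : ∀ j f → coeff (sumP (applyUpTo (λ i → f i *P g (j ∸ i)) (suc j))) A.≋ (⟦ f ⟧ AA.⊛ ⟦ g ⟧) j
  go zero    f = AR.trans (coeff-+P (f 0 *P g 0) []) (AR.trans (AR.+-identityʳ _) (coeff-*P (f 0) (g 0)))
  go (suc j) f = AR.trans (coeff-+P (f 0 *P g (suc j)) _) (AR.+-cong (coeff-*P (f 0) (g (suc j))) (go j (f ∘ suc)))

open DyckQuadratic using (u; t̂; u-⊛; dyck-quadratic)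

⟦1⟧ : ⟦ constS (+ 1) ⟧ AAR.≈ AAR.1#
⟦1⟧ zero    zero    = refl
⟦1⟧ zero    (suc k) = refl
⟦1⟧ (suc j) k       = refl

⟦2⟧ : ⟦ constS (+ 2) ⟧ AAR.≈ AAR.1# AAR.+ AAR.1#
⟦2⟧ zero    zero    = refl
⟦2⟧ zero    (suc k) = refl
⟦2⟧ (suc j) k       = refl

⟦4⟧ : ⟦ constS (+ 4) ⟧ AAR.≈ AAR.1# AAR.+ AAR.1# AAR.+ (AAR.1# AAR.+ AAR.1#)
⟦4⟧ zero    zero    = refl
⟦4⟧ zero    (suc k) = refl
⟦4⟧ (suc j) k       = refl

⟦u⟧ : ⟦ uS ⟧ AAR.≈ u
⟦u⟧ zero          k       = refl
⟦u⟧ (suc zero)    zero    = refl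
⟦u⟧ (suc zero)    (suc k) = refl
⟦u⟧ (suc (suc j)) k       = refl

⟦t⟧ : ⟦ tS ⟧ AAR.≈ t̂
⟦t⟧ zero    zero          = refl
⟦t⟧ zero    (suc zero)    = refl
⟦t⟧ zero    (suc (suc k)) = refl
⟦t⟧ (suc j) k             = refl

-- The root is obtained by solving the claimed formula for it: 1 - 2wΦ. The last equation of the
-- theorem is then formal, and the content lies in the square.
wS sqrtS : Ser
wS = (constS (+ 1) -S uS) +S (tS *S uS)
sqrtS  = constS (+ 1) -S ((constS (+ 2) *S wS) *S Φ)

w : AA.Series
w = (AAR.1# AAR.- u) AAR.+ t̂ AAR.* u

⟦w⟧ : ⟦ wS ⟧ AAR.≈ w
⟦w⟧ = AAR.trans (⟦+⟧ (constS (+ 1) -S uS) (tS *S uS))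
  (AAR.+-cong {⟦ constS (+ 1) -S uS ⟧} {AAR.1# AAR.- u} (AAR.trans (⟦-⟧ (constS (+ 1)) uS)
      (AAR.+-cong {⟦ constS (+ 1) ⟧} {AAR.1#} ⟦1⟧ (AAR.-‿cong {⟦ uS ⟧} {u} ⟦u⟧)))
    (AAR.trans (⟦*⟧ tS uS) (AAR.*-cong {⟦ tS ⟧} {t̂} ⟦t⟧ ⟦u⟧)))

⟦Φ⟧ : ⟦ Φ ⟧ AAR.≈ u AAR.* dyckGF
⟦Φ⟧ = AAR.trans shifted (AAR.sym (u-⊛ dyckGF))
  where
  shifted : ⟦ Φ ⟧ AA.≋ AA.X· dyckGF
  shifted zero    = λ _ → refl
  shifted (suc n) = coeff-Pthag n

φ : AA.Series
φ = u AAR.* dyckGF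

φ-quadratic : φ AAR.≈ u AAR.+ w AAR.* (φ AAR.* φ)
φ-quadratic = shifted-quadratic AA.ring′ u t̂ dyckGF dyck-quadratic

2wΦ : AA.Series
2wΦ = ((AAR.1# AAR.+ AAR.1#) AAR.* w) AAR.* φ

⟦2wΦ⟧ : ⟦ (constS (+ 2) *S wS) *S Φ ⟧ AAR.≈ 2wΦ
⟦2wΦ⟧ = AAR.trans (⟦*⟧ (constS (+ 2) *S wS) Φ) (AAR.*-cong {⟦ constS (+ 2) *S wS ⟧} {(AAR.1# AAR.+ AAR.1#) AAR.* w}
  (AAR.trans (⟦*⟧ (constS (+ 2)) wS) (AAR.*-cong {⟦ constS (+ 2) ⟧} {AAR.1# AAR.+ AAR.1#} ⟦2⟧ ⟦w⟧)) ⟦Φ⟧)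

⟦sqrtS⟧ : ⟦ sqrtS ⟧ AAR.≈ AAR.1# AAR.- 2wΦ
⟦sqrtS⟧ = AAR.trans (⟦-⟧ (constS (+ 1)) ((constS (+ 2) *S wS) *S Φ))
  (AAR.+-cong {⟦ constS (+ 1) ⟧} {AAR.1#} ⟦1⟧ (AAR.-‿cong {⟦ (constS (+ 2) *S wS) *S Φ ⟧} {2wΦ} ⟦2wΦ⟧))

sqrtS-constant : sqrtS 0 ≈P (+ 1 ∷ [])
sqrtS-constant k = trans (⟦sqrtS⟧ 0 k) (trans (cong (λ z → 1A k ℤ.- z) (vanish k)) (go k))
  where
  vanish : 2wΦ 0 A.≋ AR.0#
  vanish = AR.trans (AR.*-congˡ {((AAR.1# AAR.+ AAR.1#) AAR.* w) 0} (u-⊛ dyckGF 0)) (AR.zeroʳ (((AAR.1# AAR.+ AAR.1#) AAR.* w) 0))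
  go : ∀ k → 1A k ℤ.- + 0 ≡ coeff (+ 1 ∷ []) k
  go zero    = refl
  go (suc k) = refl

minus-plus : ∀ x y → (x AAR.- y) AAR.+ y AAR.≈ x
minus-plus x y = AAR.trans (AAR.+-assoc x (AAR.- y) y) (AAR.trans (AAR.+-congˡ {x} (AAR.-‿inverseˡ y)) (AAR.+-identityʳ x))

sqrtS-square : (sqrtS *S sqrtS) ≈S (constS (+ 1) -S (constS (+ 4) *S (uS *S wS)))
sqrtS-square = AAR.trans (⟦*⟧ sqrtS sqrtS)
  (AAR.trans (discriminant AA.ring′ u w φ ⟦ sqrtS ⟧ φ-quadratic
      (AAR.trans (AAR.+-congʳ {2wΦ} ⟦sqrtS⟧) (minus-plus AAR.1# 2wΦ)))
  (AAR.sym (AAR.trans (⟦-⟧ (constS (+ 1)) (constS (+ 4) *S (uS *S wS)))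
    (AAR.+-cong {⟦ constS (+ 1) ⟧} {AAR.1#} ⟦1⟧ (AAR.-‿cong {⟦ constS (+ 4) *S (uS *S wS) ⟧} {four AAR.* (u AAR.* w)}
      (AAR.trans (⟦*⟧ (constS (+ 4)) (uS *S wS)) (AAR.*-cong {⟦ constS (+ 4) ⟧} {four} ⟦4⟧
        (AAR.trans (⟦*⟧ uS wS) (AAR.*-cong {⟦ uS ⟧} {u} ⟦u⟧ ⟦w⟧)))))))))
  where
  four : AA.Series
  four = AAR.1# AAR.+ AAR.1# AAR.+ (AAR.1# AAR.+ AAR.1#)

sqrtS-solves : ((constS (+ 2) *S wS) *S Φ) ≈S (constS (+ 1) -S sqrtS)
sqrtS-solves = AAR.sym (AAR.trans (⟦-⟧ (constS (+ 1)) sqrtS) (AAR.trans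
  (AAR.+-cong {⟦ constS (+ 1) ⟧} {AAR.1#} ⟦1⟧ (AAR.-‿cong {⟦ sqrtS ⟧} {AAR.1# AAR.- 2wΦ} ⟦sqrtS⟧))
  (AAR.trans (AAR.sym (RP.x≈z//y 2wΦ (AAR.1# AAR.- 2wΦ) AAR.1# (AAR.trans (AAR.+-comm 2wΦ (AAR.1# AAR.- 2wΦ)) (minus-plus AAR.1# 2wΦ)))) (AAR.sym ⟦2wΦ⟧))))
  where module RP = RingProps AAR.ring

theorem1p1 : ((n k : ℕ) → coeff (Pthag n) k ≡ + dyckCount n k)
    × Σ Ser (λ S →
    (S 0 ≈P (+ 1 ∷ []))
    × ((S *S S) ≈S (constS (+ 1) -S (constS (+ 4) *S (uS *S ((constS (+ 1) -S uS) +S (tS *S uS))))))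
    × (((constS (+ 2) *S ((constS (+ 1) -S uS) +S (tS *S uS))) *S Φ) ≈S (constS (+ 1) -S S)))
-- `dyckGF n k` unfolds to `+ dyckCount n k`, so `coeff-Pthag` proves the first half as it stands.
theorem1p1 = coeff-Pthag , sqrtS , sqrtS-constant , sqrtS-square , sqrtS-solves
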